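{- Let $n\ge 2$ be an integer and let $p$ be a prime with $p>n+1$. Then $$\sum_{\substack{k_1+k_2+\cdots+k_n=p\\ k_i>0,\ 1\le i\le n}}\frac{(-1)^{k_1}\left(\left(\frac{k_1+1}{3}\right)-\left(\frac{k_1-1}{3}\right)\right)}{k_1k_2\cdots k_n}\equiv \begin{cases} \displaystyle -(n-2)!\sum_{r=0}^{p-n}\binom{p-n+1}{r}\frac{(3^{n+r-2}-1)(2^{n+r-2}-1)\,B_r\,B_{p-n-r+1}}{(n+r-1)6^{n+r-2}}, & \text{if } n \text{ is even},\\[3mm] -(n-1)!\left(1-\dfrac{(3^{n-1}-1)(2^{n-1}-1)}{2n\,6^{n-1}}\right)B_{p-n}, & \text{if } n \text{ is odd}, \end{cases}\pmod p.$$
   Context: The sum runs over all ordered $n$-tuples $(k_1,\dots,k_n)$ of positive integers with $k_1+\cdots+k_n=p$. For an integer $a$, $\left(\frac{a}{3}\right)$ is the Legendre symbol modulo $3$: it equals $0$ if $3\mid a$, $1$ if $a\equiv 1\pmod 3$, and $-1$ if $a\equiv 2\pmod 3$. The Bernoulli numbers $B_m$ are defined by $\frac{z}{e^z-1}=\sum_{m\ge 0}B_m\frac{z^m}{m!}$ (so $B_0=1$, $B_1=-1/2$). For rational numbers $a,b$, the congruence $a\equiv b\pmod p$ means that $a-b$ is $p$ times a rational number whose denominator is not divisible by $p$. -}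

module Defs where

open import Data.Nat as ℕ using (ℕ; zero; suc; _∸_; _%_; _!)
open import Data.Nat.Combinatorics using (_C_)
open import Data.Nat.Divisibility using (_∣_)
open import Data.Integer as ℤ using (ℤ; +_)
open import Data.Rational using (ℚ; _+_; _*_; _-_; -_; _/_; 0ℚ; 1ℚ)
open import Data.List using (List; []; _∷_; map; concatMap; upTo; foldr; _++_; zip; length)
open import Data.Vec using (Vec; []; _∷_)
open import Data.Product using (Σ; _×_)
open import Relation.Binary.PropositionalEquality using (_≡_)
open import Relation.Nullary using (¬_)

ℕ→ℚ : ℕ → ℚ
ℕ→ℚ k = (+ k) / 1

-- 1/k for k > 0 (value at 0 is irrelevant: only ever applied to positive k)
inv : ℕ → ℚ
inv zero    = 0ℚ
inv (suc k) = (+ 1) / suc k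

sumℚ : List ℚ → ℚ
sumℚ = foldr _+_ 0ℚ

leg3 : ℕ → ℚ
leg3 a with a % 3
... | 0 = 0ℚ
... | 1 = 1ℚ
... | _ = - 1ℚ

sign : ℕ → ℚ
sign zero    = 1ℚ
sign (suc k) = - sign k

-- Bernoulli numbers B_0, ..., B_m, defined by B_0 = 1 and
-- sum_{k=0}^{m} C(m+1,k) B_k = 0 for m ≥ 1 (so B_1 = -1/2),
-- i.e. the convention z/(e^z - 1) = Σ B_m z^m / m!.
bernoullis : ℕ → List ℚ
bernoullis zero    = 1ℚ ∷ []
bernoullis (suc m) =
  let bs = bernoullis m
      s  = sumℚ (map (λ { (k , b) → ℕ→ℚ ((suc (suc m)) C k) * b }) (zip (upTo (suc m)) bs))
  in bs ++ (- (inv (suc (suc m)) * s) ∷ [])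
  where open import Data.Product using (_,_)

lastOr : ℚ → List ℚ → ℚ
lastOr d []       = d
lastOr d (x ∷ xs) = lastOr x xs

B : ℕ → ℚ
B m = lastOr 0ℚ (bernoullis m)

compositions : (n : ℕ) → ℕ → List (Vec ℕ n)
compositions zero    zero    = [] ∷ []
compositions zero    (suc s) = []
compositions (suc n) s =
  concatMap (λ i → map (suc i ∷_) (compositions n (s ∸ suc i))) (upTo s)
  -- k = suc i ranges over 1..s; the remainder s - k is exact since k ≤ s

prodInv : {n : ℕ} → Vec ℕ n → ℚ
prodInv []       = 1ℚ
prodInv (k ∷ ks) = inv k * prodInv ks

summand : {n : ℕ} → Vec ℕ n → ℚ
summand []             = 0ℚ
summand (k₁ ∷ ks) =
  sign k₁ * (leg3 (suc k₁) - leg3 (k₁ ∸ 1)) * prodInv (k₁ ∷ ks)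

LHS : ℕ → ℕ → ℚ
LHS n p = sumℚ (map summand (compositions n p))

RHSeven : ℕ → ℕ → ℚ
RHSeven n p =
  - (ℕ→ℚ ((n ∸ 2) !) *
     sumℚ (map term (upTo (suc (p ∸ n)))))
  where
    term : ℕ → ℚ
    term r = ℕ→ℚ ((suc (p ∸ n)) C r)
             * ℕ→ℚ (3 ℕ.^ (n ℕ.+ r ∸ 2) ∸ 1) * ℕ→ℚ (2 ℕ.^ (n ℕ.+ r ∸ 2) ∸ 1)
             * B r * B (p ∸ n ∸ r ℕ.+ 1)
             * inv ((n ℕ.+ r ∸ 1) ℕ.* 6 ℕ.^ (n ℕ.+ r ∸ 2))

RHSodd : ℕ → ℕ → ℚ
RHSodd n p =
  - (ℕ→ℚ ((n ∸ 1) !) *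
     (1ℚ - ℕ→ℚ (3 ℕ.^ (n ∸ 1) ∸ 1) * ℕ→ℚ (2 ℕ.^ (n ∸ 1) ∸ 1)
             * inv (2 ℕ.* n ℕ.* 6 ℕ.^ (n ∸ 1)))
     * B (p ∸ n))

_≡_[modℚ_] : ℚ → ℚ → ℕ → Set
a ≡ b [modℚ p ] = Σ ℚ (λ c → (a - b ≡ ℕ→ℚ p * c) × ¬ (p ∣ ℚ.denominatorℕ c))

{-# OPTIONS --safe #-}

-- Write c_k = (−1)^k ((k+1 / 3) − (k−1 / 3)), so that Σ c_k y^k / k = − log (1 − y + y²), and ℓ = − log (1 − y).
-- The left-hand side is the coefficient of y^p in − log (1 − y + y²) ℓ^{n−1}. Modulo p, the coefficient of
-- y^{p−k} in ℓ^{n−1} is (n−1)!/k times N! [z^N] (1 − e^z)^k with N = p − n + 1: both sides satisfy the same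
-- recurrence in k and n, and Fermat's little theorem gives the case n = 2. Hence the left-hand side is
-- (n−1)! Q_N, where Q_N = N! [z^N] Σ c_k (1 − e^z)^k / k².
-- Differentiating the dilogarithm, and using 1 − y + y² = (e^{6z} − 1)(e^z − 1) / ((e^{3z} − 1)(e^{2z} − 1)) for
-- y = 1 − e^z, gives the exact formula
--   N Q_N = − Σ_r C(N, r) B⁺_r (3^m − 1)(2^m − 1) B⁺_m / m,  m = N − r,  B⁺_i = (−1)^i B_i.
-- For even n the signs cancel; for odd n only r ∈ {1, N − 1} contribute. Fermat's theorem replaces the exponent m
-- by p − 1 − m and its reciprocal.
module Submission where

open import Defs
open import Algebra.Bundles using (CommutativeRing; RawRing)
import Algebra.Solver.Ring
import Algebra.Solver.Ring.AlmostCommutativeRing as Solverᴬ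
open import Data.Integer as ℤ using (ℤ; +_)
import Data.Integer.Properties as ℤₚ
open import Data.List using (List; []; _∷_; map; concatMap; upTo; applyUpTo; _++_; zip)
import Data.List.Properties as Listₚ
open import Data.Vec using (Vec; []; _∷_)
open import Data.Maybe using (Maybe; just; nothing)
open import Data.Nat as ℕ using (ℕ; zero; suc; _∸_; z≤n; s≤s; s<s; z<s; _%_; _!)
open import Data.Nat.Combinatorics using (_C_)
import Data.Nat.Combinatorics as Comb
open import Data.Nat.Divisibility using (_∣_; divides)
import Data.Nat.Divisibility as Div
import Data.Nat.DivMod as DivMod
open import Data.Nat.Primality using (Prime; euclidsLemma)
import Data.Nat.Primality as Prim
import Data.Nat.Coprimality as Coprime
import Data.Nat.Properties as ℕₚ
open import Data.Product using (_×_; _,_; proj₁; proj₂)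
open import Data.Rational using (ℚ; mkℚ; toℚᵘ; _+_; _*_; _-_; -_; _/_; 0ℚ; 1ℚ; ½)
import Data.Rational.Properties as ℚₚ
open import Data.Rational.Unnormalised.Base as ℚᵘ using (mkℚᵘ; *≡*)
import Data.Rational.Unnormalised.Properties as ℚᵘₚ
open import Data.Sum using (inj₁; inj₂; [_,_]′)
open import Function using (_∘_; id)
open import Level using (0ℓ)
open import Relation.Binary.PropositionalEquality
  using (_≡_; refl; sym; trans; cong; cong₂; subst; subst₂; module ≡-Reasoning)
open import Relation.Binary.Bundles using (Setoid)
import Relation.Binary.Reasoning.Setoid as SetoidReasoning
open import Relation.Nullary using (¬_; yes; no; contradiction)
open import Tactic.RingSolver using (solve-∀)
open import Tactic.RingSolver.Core.AlmostCommutativeRing using (AlmostCommutativeRing; fromCommutativeRing)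

-- The polynomial 1 - y + y² is the sixth cyclotomic polynomial, and y ↦ 1 - y fixes it.
-- Substituting y = 1 - e^z therefore evaluates it at e^z, where it is a quotient of factors e^{cz}
-- - 1 with c dividing 6; each logarithmic derivative is a Bernoulli series, and the signed sum 6^m
-- - 3^m - 2^m + 1 is (3^m - 1)(2^m - 1). The square in c_k / k² has two sources: one 1/k belongs to
-- the first part of the composition, the other comes from the congruence for the powers of ℓ. What
-- shapes the proof is p in denominators. Congruences can be multiplied only by p-integral factors,
-- so integrality is carried along with them. The coefficient c_p / p never contributes, because the
-- remaining n - 1 ≥ 1 parts cannot sum to 0. B_{p-1} occurs only for n = 2 and r = 0, where γ
-- supplies two factors p. Among the exact identities, e^{cz} - 1 has no constant term and is not
-- invertible, so quotients are stated as products and the factor is cancelled afterwards.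

ℚ-ring : AlmostCommutativeRing 0ℓ 0ℓ
ℚ-ring = fromCommutativeRing ℚₚ.+-*-commutativeRing
  λ { (mkℚ (+ 0) 0 _) → just refl ; _ → nothing }

-- Embedding of the integers in the rationals.

ℤ→ℚ : ℤ → ℚ
ℤ→ℚ z = z / 1

toℚᵘ-ℤ→ℚ : ∀ z → toℚᵘ (ℤ→ℚ z) ℚᵘ.≃ mkℚᵘ z 0
toℚᵘ-ℤ→ℚ z = ℚₚ.toℚᵘ-fromℚᵘ (mkℚᵘ z 0)

ℤ→ℚ-+ : ∀ a b → ℤ→ℚ (a ℤ.+ b) ≡ ℤ→ℚ a + ℤ→ℚ b
ℤ→ℚ-+ a b = ℚₚ.toℚᵘ-injective (begin
  toℚᵘ (ℤ→ℚ (a ℤ.+ b))                   ≈⟨ toℚᵘ-ℤ→ℚ (a ℤ.+ b) ⟩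
  mkℚᵘ (a ℤ.+ b) 0
    ≈⟨ *≡* (cong (ℤ._* + 1) (sym (cong₂ ℤ._+_ (ℤₚ.*-identityʳ a) (ℤₚ.*-identityʳ b)))) ⟩
  mkℚᵘ a 0 ℚᵘ.+ mkℚᵘ b 0                   ≈⟨ ℚᵘₚ.+-cong (toℚᵘ-ℤ→ℚ a) (toℚᵘ-ℤ→ℚ b) ⟨
  toℚᵘ (ℤ→ℚ a) ℚᵘ.+ toℚᵘ (ℤ→ℚ b)       ≈⟨ ℚₚ.toℚᵘ-homo-+ (ℤ→ℚ a) (ℤ→ℚ b) ⟨
  toℚᵘ (ℤ→ℚ a + ℤ→ℚ b)                   ∎)
  where open ℚᵘₚ.≃-Reasoning

ℤ→ℚ-* : ∀ a b → ℤ→ℚ (a ℤ.* b) ≡ ℤ→ℚ a * ℤ→ℚ b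
ℤ→ℚ-* a b = ℚₚ.toℚᵘ-injective (begin
  toℚᵘ (ℤ→ℚ (a ℤ.* b))                   ≈⟨ toℚᵘ-ℤ→ℚ (a ℤ.* b) ⟩
  mkℚᵘ a 0 ℚᵘ.* mkℚᵘ b 0                   ≈⟨ ℚᵘₚ.*-cong (toℚᵘ-ℤ→ℚ a) (toℚᵘ-ℤ→ℚ b) ⟨
  toℚᵘ (ℤ→ℚ a) ℚᵘ.* toℚᵘ (ℤ→ℚ b)       ≈⟨ ℚₚ.toℚᵘ-homo-* (ℤ→ℚ a) (ℤ→ℚ b) ⟨
  toℚᵘ (ℤ→ℚ a * ℤ→ℚ b)                   ∎)
  where open ℚᵘₚ.≃-Reasoning

ℕ→ℚ-+ : ∀ a b → ℕ→ℚ (a ℕ.+ b) ≡ ℕ→ℚ a + ℕ→ℚ b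
ℕ→ℚ-+ a b = ℤ→ℚ-+ (+ a) (+ b)

ℕ→ℚ-* : ∀ a b → ℕ→ℚ (a ℕ.* b) ≡ ℕ→ℚ a * ℕ→ℚ b
ℕ→ℚ-* a b = trans (cong ℤ→ℚ (ℤₚ.pos-* a b)) (ℤ→ℚ-* (+ a) (+ b))

ℕ→ℚ-suc : ∀ a → ℕ→ℚ (suc a) ≡ 1ℚ + ℕ→ℚ a
ℕ→ℚ-suc = ℕ→ℚ-+ 1

ℕ→ℚ-∸ : ∀ {a b} → b ℕ.≤ a → ℕ→ℚ (a ∸ b) ≡ ℕ→ℚ a - ℕ→ℚ b
ℕ→ℚ-∸ {a} {b} b≤a = trans (lem (ℕ→ℚ (a ∸ b)) (ℕ→ℚ b))
  (cong (_- ℕ→ℚ b) (trans (sym (ℕ→ℚ-+ (a ∸ b) b)) (cong ℕ→ℚ (ℕₚ.m∸n+n≡m b≤a))))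
  where
  lem : ∀ x y → x ≡ (x + y) - y
  lem = solve-∀ ℚ-ring

inv-inverseˡ : ∀ k → inv (suc k) * ℕ→ℚ (suc k) ≡ 1ℚ
inv-inverseˡ k = ℚₚ.toℚᵘ-injective (begin
  toℚᵘ (inv (suc k) * ℕ→ℚ (suc k))              ≈⟨ ℚₚ.toℚᵘ-homo-* (inv (suc k)) (ℕ→ℚ (suc k)) ⟩
  toℚᵘ (inv (suc k)) ℚᵘ.* toℚᵘ (ℕ→ℚ (suc k))
    ≈⟨ ℚᵘₚ.*-cong (ℚₚ.toℚᵘ-fromℚᵘ (mkℚᵘ (+ 1) k)) (toℚᵘ-ℤ→ℚ (+ suc k)) ⟩
  mkℚᵘ (+ 1) k ℚᵘ.* mkℚᵘ (+ suc k) 0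
    ≈⟨ *≡* (cong (λ m → + m) (ℕₚ.*-assoc 1 (suc k) 1)) ⟩
  mkℚᵘ (+ 1) 0                                     ∎)
  where open ℚᵘₚ.≃-Reasoning

ℕ→ℚ-cancelˡ : ∀ k {x y} → ℕ→ℚ (suc k) * x ≡ ℕ→ℚ (suc k) * y → x ≡ y
ℕ→ℚ-cancelˡ k {x} {y} eq = trans (sym (unit x)) (trans (cong (inv (suc k) *_) eq) (unit y))
  where
  unit : ∀ z → inv (suc k) * (ℕ→ℚ (suc k) * z) ≡ z
  unit z = trans (sym (ℚₚ.*-assoc (inv (suc k)) (ℕ→ℚ (suc k)) z))
    (trans (cong (_* z) (inv-inverseˡ k)) (ℚₚ.*-identityˡ z))

-- Finite sums of rationals.

∑ : ℕ → (ℕ → ℚ) → ℚ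
∑ zero    f = 0ℚ
∑ (suc n) f = f 0 + ∑ n (f ∘ suc)

∑-cong : ∀ n {f g} → (∀ i → i ℕ.< n → f i ≡ g i) → ∑ n f ≡ ∑ n g
∑-cong zero    e = refl
∑-cong (suc n) e = cong₂ _+_ (e 0 z<s) (∑-cong n (λ i i<n → e (suc i) (s<s i<n)))

∑-last : ∀ n f → ∑ (suc n) f ≡ ∑ n f + f n
∑-last zero    f = ℚₚ.+-comm (f 0) 0ℚ
∑-last (suc n) f = trans (cong (_+_ (f 0)) (∑-last n (f ∘ suc))) (sym (ℚₚ.+-assoc (f 0) (∑ n (f ∘ suc)) (f (suc n))))

∑-+ : ∀ n f g → ∑ n (λ i → f i + g i) ≡ ∑ n f + ∑ n g
∑-+ zero    f g = refl
∑-+ (suc n) f g = trans (cong (_+_ (f 0 + g 0)) (∑-+ n (f ∘ suc) (g ∘ suc))) (lem (f 0) (g 0) (∑ n (f ∘ suc)) (∑ n (g ∘ suc)))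
  where
  lem : ∀ a b c d → a + b + (c + d) ≡ a + c + (b + d)
  lem = solve-∀ ℚ-ring

∑-*ˡ : ∀ n c f → ∑ n (λ i → c * f i) ≡ c * ∑ n f
∑-*ˡ zero    c f = sym (ℚₚ.*-zeroʳ c)
∑-*ˡ (suc n) c f = trans (cong (_+_ (c * f 0)) (∑-*ˡ n c (f ∘ suc))) (sym (ℚₚ.*-distribˡ-+ c (f 0) (∑ n (f ∘ suc))))

∑-0 : ∀ n {f} → (∀ i → i ℕ.< n → f i ≡ 0ℚ) → ∑ n f ≡ 0ℚ
∑-0 zero    e = refl
∑-0 (suc n) e = cong₂ _+_ (e 0 z<s) (∑-0 n (λ i i<n → e (suc i) (s<s i<n)))

-- The ring of exponential generating functions.

Seq : Set
Seq = ℕ → ℚ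

infix 4 _≐_
_≐_ : Seq → Seq → Set
a ≐ b = ∀ n → a n ≡ b n

infixl 6 _⊕_
infixl 7 _⊛_ _·_
infix 8 ⊖_

_⊕_ : Seq → Seq → Seq
(a ⊕ b) n = a n + b n

⊖_ : Seq → Seq
(⊖ a) n = - a n

_·_ : ℚ → Seq → Seq
(c · a) n = c * a n

const : ℚ → Seq
const c zero    = c
const c (suc _) = 0ℚ

-- A sequence a stands for the exponential generating function Σ aₙ zⁿ/n!, on which the shift
-- is d/dz; the product is determined by the Leibniz rule.
_⊛_ : Seq → Seq → Seq
(a ⊛ b) zero    = a 0 * b 0
(a ⊛ b) (suc n) = ((a ∘ suc) ⊛ b) n + (a ⊛ (b ∘ suc)) n

⊛-cong : ∀ {a a′ b b′} → a ≐ a′ → b ≐ b′ → a ⊛ b ≐ a′ ⊛ b′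
⊛-cong p q zero    = cong₂ _*_ (p 0) (q 0)
⊛-cong p q (suc n) = cong₂ _+_ (⊛-cong (p ∘ suc) q n) (⊛-cong p (q ∘ suc) n)

⊛-comm : ∀ a b → a ⊛ b ≐ b ⊛ a
⊛-comm a b zero    = ℚₚ.*-comm (a 0) (b 0)
⊛-comm a b (suc n) = trans (cong₂ _+_ (⊛-comm (a ∘ suc) b n) (⊛-comm a (b ∘ suc) n))
  (ℚₚ.+-comm ((b ⊛ (a ∘ suc)) n) (((b ∘ suc) ⊛ a) n))

⊛-distribʳ : ∀ c a b → (a ⊕ b) ⊛ c ≐ (a ⊛ c) ⊕ (b ⊛ c)
⊛-distribʳ c a b zero    = ℚₚ.*-distribʳ-+ (c 0) (a 0) (b 0)
⊛-distribʳ c a b (suc n) = trans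
  (cong₂ _+_ (⊛-distribʳ c (a ∘ suc) (b ∘ suc) n) (⊛-distribʳ (c ∘ suc) a b n))
  (lem (((a ∘ suc) ⊛ c) n) (((b ∘ suc) ⊛ c) n) ((a ⊛ (c ∘ suc)) n) ((b ⊛ (c ∘ suc)) n))
  where
  lem : ∀ x y z w → x + y + (z + w) ≡ x + z + (y + w)
  lem = solve-∀ ℚ-ring

⊛-distribˡ : ∀ c a b → c ⊛ (a ⊕ b) ≐ (c ⊛ a) ⊕ (c ⊛ b)
⊛-distribˡ c a b n = trans (⊛-comm c (a ⊕ b) n)
  (trans (⊛-distribʳ c a b n) (cong₂ _+_ (⊛-comm a c n) (⊛-comm b c n)))

⊛-assoc : ∀ a b c → (a ⊛ b) ⊛ c ≐ a ⊛ (b ⊛ c)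
⊛-assoc a b c zero    = ℚₚ.*-assoc (a 0) (b 0) (c 0)
⊛-assoc a b c (suc n) = begin
  (((a ∘ suc) ⊛ b ⊕ a ⊛ (b ∘ suc)) ⊛ c) n + ((a ⊛ b) ⊛ (c ∘ suc)) n
    ≡⟨ cong (_+ ((a ⊛ b) ⊛ (c ∘ suc)) n) (⊛-distribʳ c ((a ∘ suc) ⊛ b) (a ⊛ (b ∘ suc)) n) ⟩
  (((a ∘ suc) ⊛ b) ⊛ c) n + ((a ⊛ (b ∘ suc)) ⊛ c) n + ((a ⊛ b) ⊛ (c ∘ suc)) n
    ≡⟨ cong₂ _+_ (cong₂ _+_ (⊛-assoc (a ∘ suc) b c n) (⊛-assoc a (b ∘ suc) c n)) (⊛-assoc a b (c ∘ suc) n) ⟩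
  ((a ∘ suc) ⊛ (b ⊛ c)) n + (a ⊛ ((b ∘ suc) ⊛ c)) n + (a ⊛ (b ⊛ (c ∘ suc))) n
    ≡⟨ ℚₚ.+-assoc (((a ∘ suc) ⊛ (b ⊛ c)) n) ((a ⊛ ((b ∘ suc) ⊛ c)) n) ((a ⊛ (b ⊛ (c ∘ suc))) n) ⟩
  ((a ∘ suc) ⊛ (b ⊛ c)) n + ((a ⊛ ((b ∘ suc) ⊛ c)) n + (a ⊛ (b ⊛ (c ∘ suc))) n)
    ≡⟨ cong (_+_ (((a ∘ suc) ⊛ (b ⊛ c)) n)) (sym (⊛-distribˡ a ((b ∘ suc) ⊛ c) (b ⊛ (c ∘ suc)) n)) ⟩
  ((a ∘ suc) ⊛ (b ⊛ c)) n + (a ⊛ ((b ∘ suc) ⊛ c ⊕ b ⊛ (c ∘ suc))) n ∎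
  where open ≡-Reasoning

const-⊛ : ∀ c a → const c ⊛ a ≐ c · a
const-⊛ c a zero    = refl
const-⊛ c a (suc n) = trans (cong₂ _+_ (⊛-zeroˡ a n) (const-⊛ c (a ∘ suc) n)) (ℚₚ.+-identityˡ (c * a (suc n)))
  where
  ⊛-zeroˡ : ∀ b m → ((λ _ → 0ℚ) ⊛ b) m ≡ 0ℚ
  ⊛-zeroˡ b zero    = ℚₚ.*-zeroˡ (b 0)
  ⊛-zeroˡ b (suc m) = cong₂ _+_ (⊛-zeroˡ b m) (⊛-zeroˡ (b ∘ suc) m)

·-⊛ : ∀ c a b → (c · a) ⊛ b ≐ c · (a ⊛ b)
·-⊛ c a b n = begin
  ((c · a) ⊛ b) n       ≡⟨ ⊛-cong {b = b} (λ m → sym (const-⊛ c a m)) (λ _ → refl) n ⟩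
  ((const c ⊛ a) ⊛ b) n ≡⟨ ⊛-assoc (const c) a b n ⟩
  (const c ⊛ (a ⊛ b)) n ≡⟨ const-⊛ c (a ⊛ b) n ⟩
  c * (a ⊛ b) n         ∎
  where open ≡-Reasoning

⊛-·-comm : ∀ c a b → a ⊛ (c · b) ≐ c · (a ⊛ b)
⊛-·-comm c a b n = trans (⊛-comm a (c · b) n) (trans (·-⊛ c b a n) (cong (c *_) (⊛-comm b a n)))

const-0 : ∀ n → const 0ℚ n ≡ 0ℚ
const-0 zero    = refl
const-0 (suc n) = refl

-- Known as the ring of Hurwitz series. As a bundle it makes the ring solver available, so that
-- identities between series reduce to polynomial identities.
Hurwitz : CommutativeRing 0ℓ 0ℓ
Hurwitz = record
  { Carrier = Seq ; _≈_ = _≐_ ; _+_ = _⊕_ ; _*_ = _⊛_ ; -_ = ⊖_ ; 0# = const 0ℚ ; 1# = const 1ℚ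
  ; isCommutativeRing = record
    { isRing = record
      { +-isAbelianGroup = record
        { isGroup = record
          { isMonoid = record
            { isSemigroup = record
              { isMagma = record
                { isEquivalence = record
                  { refl = λ _ → refl ; sym = λ p n → sym (p n) ; trans = λ p q n → trans (p n) (q n) }
                ; ∙-cong = λ p q n → cong₂ _+_ (p n) (q n) }
              ; assoc = λ a b c n → ℚₚ.+-assoc (a n) (b n) (c n) }
            ; identity = (λ a n → trans (cong (_+ a n) (const-0 n)) (ℚₚ.+-identityˡ (a n)))
                       , (λ a n → trans (cong (_+_ (a n)) (const-0 n)) (ℚₚ.+-identityʳ (a n))) }
          ; inverse = (λ a n → trans (ℚₚ.+-inverseˡ (a n)) (sym (const-0 n)))
                    , (λ a n → trans (ℚₚ.+-inverseʳ (a n)) (sym (const-0 n)))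
          ; ⁻¹-cong = λ p n → cong -_ (p n) }
        ; comm = λ a b n → ℚₚ.+-comm (a n) (b n) }
      ; *-cong = ⊛-cong
      ; *-assoc = ⊛-assoc
      ; *-identity = ⊛-identityˡ , (λ a n → trans (⊛-comm a (const 1ℚ) n) (⊛-identityˡ a n))
      ; distrib = ⊛-distribˡ , ⊛-distribʳ }
    ; *-comm = ⊛-comm } }
  where
  ⊛-identityˡ : ∀ a → const 1ℚ ⊛ a ≐ a
  ⊛-identityˡ a n = trans (const-⊛ 1ℚ a n) (ℚₚ.*-identityˡ (a n))

module H = CommutativeRing Hurwitz

ℚ-rawRing : RawRing 0ℓ 0ℓ
ℚ-rawRing = Solverᴬ.AlmostCommutativeRing.rawRing (Solverᴬ.fromCommutativeRing ℚₚ.+-*-commutativeRing)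

const-homo : ℚ-rawRing Solverᴬ.-Raw-AlmostCommutative⟶ Solverᴬ.fromCommutativeRing Hurwitz
const-homo = record
  { ⟦_⟧    = const
  ; +-homo = λ { x y zero → refl ; x y (suc n) → refl }
  ; *-homo = λ { x y zero → refl ; x y (suc n) → sym (trans (const-⊛ x (const y) (suc n)) (ℚₚ.*-zeroʳ x)) }
  ; -‿homo = λ { x zero → refl ; x (suc n) → refl }
  ; 0-homo = λ _ → refl
  ; 1-homo = λ _ → refl
  }

const-≟ : ∀ x y → Maybe (const x ≐ const y)
const-≟ x y with x ℚₚ.≟ y
... | yes refl = just (λ _ → refl)
... | no  _    = nothing

module HurwitzSolver =
  Algebra.Solver.Ring ℚ-rawRing (Solverᴬ.fromCommutativeRing Hurwitz) const-homo const-≟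

open HurwitzSolver using (_:+_; _:*_; :-_; _:-_; _:=_; con)

Z : Seq
Z 1 = 1ℚ
Z _ = 0ℚ

-- `Z` is the series z. The factor n + 1 produced here is the N in front of Q_N in the exact
-- formula, and it makes multiplication by z cancellable.
Z-⊛-suc : ∀ a n → (Z ⊛ a) (suc n) ≡ ℕ→ℚ (suc n) * a n
Z-⊛-suc a n = trans (cong (_+ (Z ⊛ (a ∘ suc)) n) (trans (⊛-cong {b = a} Z′ (λ _ → refl) n) (H.*-identityˡ a n))) (step n)
  where
  Z′ : Z ∘ suc ≐ const 1ℚ
  Z′ zero    = refl
  Z′ (suc n) = refl
  lem : ∀ x y → x + y * x ≡ (1ℚ + y) * x
  lem = solve-∀ ℚ-ring
  step : ∀ n → a n + (Z ⊛ (a ∘ suc)) n ≡ ℕ→ℚ (suc n) * a n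
  step zero    = trans (cong (_+_ (a 0)) (ℚₚ.*-zeroˡ (a 1))) (lem0 (a 0))
    where
    lem0 : ∀ x → x + 0ℚ ≡ 1ℚ * x
    lem0 = solve-∀ ℚ-ring
  step (suc n) = trans (cong (_+_ (a (suc n))) (Z-⊛-suc (a ∘ suc) n))
    (trans (lem (a (suc n)) (ℕ→ℚ (suc n))) (cong (_* a (suc n)) (sym (ℕ→ℚ-suc (suc n)))))

Z-cancel : ∀ {a} → Z ⊛ a ≐ const 0ℚ → a ≐ const 0ℚ
Z-cancel {a} e n = ℕ→ℚ-cancelˡ n (trans (sym (Z-⊛-suc a n)) (trans (e (suc n)) (sym (trans (cong (ℕ→ℚ (suc n) *_) (const-0 n)) (ℚₚ.*-zeroʳ (ℕ→ℚ (suc n)))))))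

⊛-binomial : ∀ a b n → (a ⊛ b) n ≡ ∑ (suc n) (λ r → ℕ→ℚ (n C r) * a r * b (n ∸ r))
⊛-binomial a b zero = lem (a 0) (b 0)
  where
  lem : ∀ x y → x * y ≡ 1ℚ * x * y + 0ℚ
  lem = solve-∀ ℚ-ring
⊛-binomial a b (suc n) = begin
  ((a ∘ suc) ⊛ b) n + (a ⊛ (b ∘ suc)) n
    ≡⟨ cong₂ _+_ (⊛-binomial (a ∘ suc) b n) (⊛-binomial a (b ∘ suc) n) ⟩
  ∑ (suc n) f + ∑ (suc n) (λ r → ℕ→ℚ (n C r) * a r * b (suc (n ∸ r)))
    ≡⟨ cong (_+_ (∑ (suc n) f)) (∑-cong (suc n) λ r r≤n →
         cong (λ m → ℕ→ℚ (n C r) * a r * b m) (sym (ℕₚ.+-∸-assoc 1 (ℕ.s≤s⁻¹ r≤n)))) ⟩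
  ∑ (suc n) f + ∑ (suc n) g
    -- The second sum is extended by its term r = n + 1, which is 0 since n C (n + 1) = 0; peeling
    -- off r = 0 instead aligns both sums for Pascal's rule.
    ≡⟨ cong (_+_ (∑ (suc n) f)) (trans (sym (ℚₚ.+-identityʳ (∑ (suc n) g)))
         (trans (cong (_+_ (∑ (suc n) g)) (sym g-last)) (sym (∑-last (suc n) g)))) ⟩
  ∑ (suc n) f + (g 0 + ∑ (suc n) (g ∘ suc))
    ≡⟨ lem (∑ (suc n) f) (g 0) (∑ (suc n) (g ∘ suc)) ⟩
  g 0 + (∑ (suc n) f + ∑ (suc n) (g ∘ suc))
    ≡⟨ cong (_+_ (g 0)) (trans (sym (∑-+ (suc n) f (g ∘ suc))) (∑-cong (suc n) (λ r _ → pascal r))) ⟩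
  ∑ (suc (suc n)) (λ r → ℕ→ℚ (suc n C r) * a r * b (suc n ∸ r)) ∎
  where
  open ≡-Reasoning
  f g : ℕ → ℚ
  f r = ℕ→ℚ (n C r) * a (suc r) * b (n ∸ r)
  g r = ℕ→ℚ (n C r) * a r * b (suc n ∸ r)
  lem : ∀ x y z → x + (y + z) ≡ y + (x + z)
  lem = solve-∀ ℚ-ring
  lem′ : ∀ c d x y → c * x * y + d * x * y ≡ (c + d) * x * y
  lem′ = solve-∀ ℚ-ring
  lem″ : ∀ x y → 0ℚ * x * y ≡ 0ℚ
  lem″ = solve-∀ ℚ-ring
  g-last : g (suc n) ≡ 0ℚ
  g-last = trans (cong (λ m → ℕ→ℚ m * a (suc n) * b (n ∸ n)) (Comb.k>n⇒nCk≡0 (ℕₚ.n<1+n n)))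
    (lem″ (a (suc n)) (b (n ∸ n)))
  pascal : ∀ r → f r + g (suc r) ≡ ℕ→ℚ (suc n C suc r) * a (suc r) * b (n ∸ r)
  pascal r = trans (lem′ (ℕ→ℚ (n C r)) (ℕ→ℚ (n C suc r)) (a (suc r)) (b (n ∸ r)))
    (cong (λ c → c * a (suc r) * b (n ∸ r))
      (trans (sym (ℕ→ℚ-+ (n C r) (n C suc r))) (cong ℕ→ℚ (Comb.nCk+nC[k+1]≡[n+1]C[k+1] n r))))

-- The exponentials e^{cz} and the substitution z ↦ c z.

pow : ℚ → Seq
pow c zero    = 1ℚ
pow c (suc n) = c * pow c n

e : Seq
e = pow 1ℚ

e≡1 : ∀ n → e n ≡ 1ℚ
e≡1 zero    = refl
e≡1 (suc n) = trans (ℚₚ.*-identityˡ (e n)) (e≡1 n)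

-- `pow c` is the series e^{cz}; both sides solve f′ = (c + d) f with value 1 at z = 0.
pow-+ : ∀ c d → pow (c + d) ≐ pow c ⊛ pow d
pow-+ c d zero    = refl
pow-+ c d (suc n) = begin
  (c + d) * pow (c + d) n
    ≡⟨ cong ((c + d) *_) (pow-+ c d n) ⟩
  (c + d) * (pow c ⊛ pow d) n
    ≡⟨ ℚₚ.*-distribʳ-+ ((pow c ⊛ pow d) n) c d ⟩
  c * (pow c ⊛ pow d) n + d * (pow c ⊛ pow d) n
    ≡⟨ cong₂ _+_ (sym (·-⊛ c (pow c) (pow d) n)) (sym (⊛-·-comm d (pow c) (pow d) n)) ⟩
  ((c · pow c) ⊛ pow d) n + (pow c ⊛ (d · pow d)) n ∎
  where open ≡-Reasoning

pow-0 : ∀ {n} → 0 ℕ.< n → pow 0ℚ n ≡ 0ℚ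
pow-0 {suc n} _ = ℚₚ.*-zeroˡ (pow 0ℚ n)

pow-split : ∀ c a b → pow c (a ℕ.+ b) ≡ pow c a * pow c b
pow-split c zero    b = sym (ℚₚ.*-identityˡ (pow c b))
pow-split c (suc a) b = trans (cong (c *_) (pow-split c a b)) (sym (ℚₚ.*-assoc c (pow c a) (pow c b)))

pow-distrib : ∀ c d n → pow (c * d) n ≡ pow c n * pow d n
pow-distrib c d zero    = refl
pow-distrib c d (suc n) = trans (cong (c * d *_) (pow-distrib c d n)) (lem c d (pow c n) (pow d n))
  where
  lem : ∀ x y z w → x * y * (z * w) ≡ x * z * (y * w)
  lem = solve-∀ ℚ-ring

pow-ℕ : ∀ a n → ℕ→ℚ (a ℕ.^ n) ≡ pow (ℕ→ℚ a) n
pow-ℕ a zero    = refl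
pow-ℕ a (suc n) = trans (ℕ→ℚ-* a (a ℕ.^ n)) (cong (ℕ→ℚ a *_) (pow-ℕ a n))

-- The substitution z ↦ c z on exponential generating functions.
scale : ℚ → Seq → Seq
scale c a n = pow c n * a n

scale-⊛ : ∀ c a b → scale c (a ⊛ b) ≐ scale c a ⊛ scale c b
scale-⊛ c a b zero    = lem (a 0) (b 0)
  where
  lem : ∀ x y → 1ℚ * (x * y) ≡ 1ℚ * x * (1ℚ * y)
  lem = solve-∀ ℚ-ring
scale-⊛ c a b (suc n) = begin
  c * pow c n * (((a ∘ suc) ⊛ b) n + (a ⊛ (b ∘ suc)) n)
    ≡⟨ lem c (pow c n) (((a ∘ suc) ⊛ b) n) ((a ⊛ (b ∘ suc)) n) ⟩
  c * (pow c n * ((a ∘ suc) ⊛ b) n) + c * (pow c n * (a ⊛ (b ∘ suc)) n)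
    ≡⟨ cong₂ (λ x y → c * x + c * y) (scale-⊛ c (a ∘ suc) b n) (scale-⊛ c a (b ∘ suc) n) ⟩
  c * (scale c (a ∘ suc) ⊛ scale c b) n + c * (scale c a ⊛ scale c (b ∘ suc)) n
    ≡⟨ cong₂ _+_ (sym (·-⊛ c (scale c (a ∘ suc)) (scale c b) n)) (sym (⊛-·-comm c (scale c a) (scale c (b ∘ suc)) n)) ⟩
  ((c · scale c (a ∘ suc)) ⊛ scale c b) n + (scale c a ⊛ (c · scale c (b ∘ suc))) n
    ≡⟨ cong₂ _+_ (⊛-cong {b = scale c b} (shift a) (λ _ → refl) n) (⊛-cong {a = scale c a} (λ _ → refl) (shift b) n) ⟩
  ((scale c a ∘ suc) ⊛ scale c b) n + (scale c a ⊛ (scale c b ∘ suc)) n ∎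
  where
  open ≡-Reasoning
  lem : ∀ x y z w → x * y * (z + w) ≡ x * (y * z) + x * (y * w)
  lem = solve-∀ ℚ-ring
  shift : ∀ d → c · scale c (d ∘ suc) ≐ scale c d ∘ suc
  shift d m = sym (ℚₚ.*-assoc c (pow c m) (d (suc m)))

scale-e : ∀ c → scale c e ≐ pow c
scale-e c n = trans (cong (pow c n *_) (e≡1 n)) (ℚₚ.*-identityʳ (pow c n))

scale-Z : ∀ c → scale c Z ≐ const c ⊛ Z
scale-Z c n = trans (lem n) (sym (const-⊛ c Z n))
  where
  lem : ∀ n → scale c Z n ≡ c * Z n
  lem zero          = trans (ℚₚ.*-zeroʳ 1ℚ) (sym (ℚₚ.*-zeroʳ c))
  lem (suc zero)    = cong (_* 1ℚ) (ℚₚ.*-identityʳ c)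
  lem (suc (suc n)) = trans (ℚₚ.*-zeroʳ (pow c (suc (suc n)))) (sym (ℚₚ.*-zeroʳ c))

-- Bernoulli numbers as the series z / (e^z - 1).

sumℚ-map-applyUpTo : ∀ n (f : ℕ → ℚ) g → sumℚ (map f (applyUpTo g n)) ≡ ∑ n (f ∘ g)
sumℚ-map-applyUpTo zero    f g = refl
sumℚ-map-applyUpTo (suc n) f g = cong (_+_ (f (g 0))) (sumℚ-map-applyUpTo n f (g ∘ suc))

sumℚ-zip : ∀ n (h : ℕ × ℚ → ℚ) f g →
  sumℚ (map h (zip (applyUpTo f n) (applyUpTo g n))) ≡ ∑ n (λ i → h (f i , g i))
sumℚ-zip zero    h f g = refl
sumℚ-zip (suc n) h f g = cong (_+_ (h (f 0 , g 0))) (sumℚ-zip n h (f ∘ suc) (g ∘ suc))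

lastOr-++ : ∀ d xs x → lastOr d (xs ++ (x ∷ [])) ≡ x
lastOr-++ d []       x = refl
lastOr-++ d (y ∷ xs) x = lastOr-++ y xs x

-- Entries are only ever appended, so all the lists are prefixes of one sequence; this turns the
-- definition by lists into the recursion `B-suc`.
bernoullis≡ : ∀ m → bernoullis m ≡ applyUpTo B (suc m)
bernoullis≡ zero    = refl
bernoullis≡ (suc m) = trans
  (cong₂ (λ xs x → xs ++ (x ∷ [])) (bernoullis≡ m) (sym (lastOr-++ 0ℚ (bernoullis m) _)))
  (Listₚ.applyUpTo-∷ʳ B (suc m))

B-suc : ∀ m → B (suc m) ≡ - (inv (suc (suc m)) * ∑ (suc m) (λ k → ℕ→ℚ (suc (suc m) C k) * B k))
B-suc m = trans (lastOr-++ 0ℚ (bernoullis m) _) (cong (λ s → - (inv (suc (suc m)) * s))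
  (trans (cong (λ bs → sumℚ (map h (zip (upTo (suc m)) bs))) (bernoullis≡ m))
    (sumℚ-zip (suc m) h id B)))
  where
  h : ℕ × ℚ → ℚ
  h (k , b) = ℕ→ℚ (suc (suc m) C k) * b

B⁺ : Seq
B⁺ = e ⊛ B

-- With `B` read as z / (e^z - 1), this is (e^z - 1) · z / (e^z - 1) = z. For n ≥ 2 the binomial
-- terms below r = n cancel by the recursion for B_{n-1}.
B⁺-def : B⁺ ≐ B ⊕ Z
B⁺-def n = trans (⊛-comm e B n) (trans (⊛-binomial B e n)
  (trans (∑-cong (suc n) (λ r _ → trans (cong (ℕ→ℚ (n C r) * B r *_) (e≡1 (n ∸ r))) (ℚₚ.*-identityʳ (ℕ→ℚ (n C r) * B r)))) (lem n)))
  where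
  lem : ∀ n → ∑ (suc n) (λ r → ℕ→ℚ (n C r) * B r) ≡ B n + Z n
  lem zero          = refl
  lem (suc zero)    = refl
  lem (suc (suc m)) = begin
    ∑ (suc (suc (suc m))) g                     ≡⟨ ∑-last (suc (suc m)) g ⟩
    ∑ (suc (suc m)) g + g (suc (suc m))         ≡⟨ cong (_+ g (suc (suc m))) (∑-last (suc m) g) ⟩
    ∑ (suc m) g + g (suc m) + g (suc (suc m))
      ≡⟨ cong₂ (λ x y → ∑ (suc m) g + x * B (suc m) + y * B (suc (suc m)))
           (cong ℕ→ℚ (trans (Comb.nCk≡nC[n∸k] (ℕₚ.n≤1+n (suc m)))
              (trans (cong (suc (suc m) C_) (ℕₚ.m+n∸n≡m 1 (suc m))) (Comb.nC1≡n (suc (suc m))))))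
           (cong ℕ→ℚ (Comb.nCn≡1 (suc (suc m)))) ⟩
    ∑ (suc m) g + ℕ→ℚ (suc (suc m)) * B (suc m) + 1ℚ * B (suc (suc m))
      ≡⟨ cong (λ x → ∑ (suc m) g + ℕ→ℚ (suc (suc m)) * x + 1ℚ * B (suc (suc m))) (B-suc m) ⟩
    ∑ (suc m) g + ℕ→ℚ (suc (suc m)) * - (inv (suc (suc m)) * ∑ (suc m) g) + 1ℚ * B (suc (suc m))
      ≡⟨ alg (∑ (suc m) g) (ℕ→ℚ (suc (suc m))) (inv (suc (suc m))) (B (suc (suc m))) ⟩
    (1ℚ - inv (suc (suc m)) * ℕ→ℚ (suc (suc m))) * ∑ (suc m) g + B (suc (suc m))
      ≡⟨ cong (λ x → (1ℚ - x) * ∑ (suc m) g + B (suc (suc m))) (inv-inverseˡ (suc m)) ⟩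
    (1ℚ - 1ℚ) * ∑ (suc m) g + B (suc (suc m))
      ≡⟨ alg′ (∑ (suc m) g) (B (suc (suc m))) ⟩
    B (suc (suc m)) + 0ℚ                        ∎
    where
    open ≡-Reasoning
    g : ℕ → ℚ
    g r = ℕ→ℚ (suc (suc m) C r) * B r
    alg : ∀ s n i b → s + n * - (i * s) + 1ℚ * b ≡ (1ℚ - i * n) * s + b
    alg = solve-∀ ℚ-ring
    alg′ : ∀ s b → (1ℚ - 1ℚ) * s + b ≡ b + 0ℚ
    alg′ = solve-∀ ℚ-ring

-- Relations among the series c z / (e^{cz} - 1).

0ˢ : Seq
0ˢ = const 0ℚ

⊛-vanish : ∀ c {x} → x ≐ 0ˢ → c ⊛ x ≐ 0ˢ
⊛-vanish c p = H.trans (⊛-cong {a = c} (λ _ → refl) p) (H.zeroʳ c)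

⊕-vanish : ∀ {x y} → x ≐ 0ˢ → y ≐ 0ˢ → x ⊕ y ≐ 0ˢ
⊕-vanish p q = H.trans (H.+-cong p q) (H.+-identityˡ 0ˢ)

difference : ∀ {x y} → x ≐ y → x ⊕ ⊖ y ≐ 0ˢ
difference {x} {y} p = H.trans (H.+-cong p (H.refl {⊖ y})) (H.-‿inverseʳ y)

-- `scale c B` is c z / (e^{cz} - 1), and this is its defining relation, obtained from `B⁺-def` by z
-- ↦ c z.
scale-B : ∀ c → pow c ⊛ scale c B ≐ scale c B ⊕ const c ⊛ Z
scale-B c n = begin
  (pow c ⊛ scale c B) n          ≡⟨ ⊛-cong {b = scale c B} (λ m → sym (scale-e c m)) (λ _ → refl) n ⟩
  (scale c e ⊛ scale c B) n      ≡⟨ scale-⊛ c e B n ⟨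
  pow c n * (e ⊛ B) n            ≡⟨ cong (pow c n *_) (B⁺-def n) ⟩
  pow c n * (B n + Z n)          ≡⟨ ℚₚ.*-distribˡ-+ (pow c n) (B n) (Z n) ⟩
  scale c B n + scale c Z n      ≡⟨ cong (_+_ (scale c B n)) (scale-Z c n) ⟩
  (scale c B ⊕ const c ⊛ Z) n    ∎
  where open ≡-Reasoning

-- For y = 1 − e^z one has 1 − y + y² = (e^{6z} − 1)(e^z − 1) / ((e^{3z} − 1)(e^{2z} − 1)); the hypotheses
-- say that g is z ↦ d/dz (− log (1 − y + y²)) and that b_c = c z / (e^{cz} − 1).
log-derivative : ∀ x z g b₁ b₂ b₃ b₆ →
  (const 1ℚ ⊕ ⊖ x ⊕ x ⊛ x) ⊛ g ≐ x ⊕ ⊖ (const (ℕ→ℚ 2) ⊛ (x ⊛ x)) →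
  x ⊛ b₁ ≐ b₁ ⊕ const (ℕ→ℚ 1) ⊛ z →
  (x ⊛ x) ⊛ b₂ ≐ b₂ ⊕ const (ℕ→ℚ 2) ⊛ z →
  (x ⊛ x ⊛ x) ⊛ b₃ ≐ b₃ ⊕ const (ℕ→ℚ 3) ⊛ z →
  ((x ⊛ x ⊛ x) ⊛ (x ⊛ x ⊛ x)) ⊛ b₆ ≐ b₆ ⊕ const (ℕ→ℚ 6) ⊛ z →
  ((x ⊛ x ⊛ x) ⊛ (x ⊛ x ⊛ x) ⊕ ⊖ const 1ℚ) ⊛
    (z ⊛ g ⊕ (x ⊛ x ⊛ x) ⊛ (x ⊛ x ⊛ x) ⊛ b₆ ⊕ x ⊛ b₁ ⊕ ⊖ ((x ⊛ x) ⊛ b₂) ⊕ ⊖ ((x ⊛ x ⊛ x) ⊛ b₃)) ≐ 0ˢ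
log-derivative x z g b₁ b₂ b₃ b₆ hg h₁ h₂ h₃ h₆ = H.trans
  (HurwitzSolver.solve 7 (λ x z g b₁ b₂ b₃ b₆ →
     let 1′ = con 1ℚ; x² = x :* x; x³ = x :* x :* x; x⁶ = x³ :* x³ in
     (x⁶ :+ :- 1′) :* (z :* g :+ x³ :* x³ :* b₆ :+ x :* b₁ :+ :- (x² :* b₂) :+ :- (x³ :* b₃))
     -- Multiplying by x⁶ - 1 clears every denominator. Each hypothesis enters with a cofactor in x⁶
     -- - 1: (1 + x)(x³ - 1) is that of 1 - x + x², and b_c gets x^c (x⁶ - 1) / (x^c - 1), up to
     -- sign.
     := z :* (1′ :+ x) :* (x³ :- 1′) :* ((1′ :+ :- x :+ x :* x) :* g :+ :- (x :+ :- (con (ℕ→ℚ 2) :* x²)))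
        :+ x³ :* x³ :* (x³ :* x³ :* b₆ :+ :- (b₆ :+ con (ℕ→ℚ 6) :* z))
        :+ x :* (1′ :+ x :+ x² :+ x³ :+ x³ :* x :+ x³ :* x²) :* (x :* b₁ :+ :- (b₁ :+ con (ℕ→ℚ 1) :* z))
        :+ :- (x² :* (1′ :+ x² :+ x³ :* x)) :* (x² :* b₂ :+ :- (b₂ :+ con (ℕ→ℚ 2) :* z))
        :+ :- (x³ :* (1′ :+ x³)) :* (x³ :* b₃ :+ :- (b₃ :+ con (ℕ→ℚ 3) :* z)))
     (λ _ → refl) x z g b₁ b₂ b₃ b₆)
  (⊕-vanish (⊕-vanish (⊕-vanish (⊕-vanish
    (⊛-vanish _ (difference hg)) (⊛-vanish _ (difference h₆)))
    (⊛-vanish _ (difference h₁))) (⊛-vanish _ (difference h₂))) (⊛-vanish _ (difference h₃)))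

-- With k = c + 1, multiplication by `scale k B` turns the factor e^{kz} - 1 into k z, and both k
-- and z can be cancelled coefficientwise.
pow-cancel : ∀ c a → (pow (ℕ→ℚ (suc c)) ⊕ ⊖ const 1ℚ) ⊛ a ≐ 0ˢ → a ≐ 0ˢ
pow-cancel c a p = λ n → ℕ→ℚ-cancelˡ c (trans (sym (const-⊛ k a n))
  (trans (Z-cancel q n) (sym (trans (sym (const-⊛ k 0ˢ n)) (H.zeroʳ (const k) n)))))
  where
  k = ℕ→ℚ (suc c)
  b = scale k B
  q : Z ⊛ (const k ⊛ a) ≐ 0ˢ
  q = H.trans
    (HurwitzSolver.solve 5 (λ x z b a k → z :* (k :* a)
       := b :* ((x :+ :- con 1ℚ) :* a) :+ :- a :* (x :* b :+ :- (b :+ k :* z))) (λ _ → refl) (pow k) Z b a (const k))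
    (⊕-vanish (⊛-vanish b p) (⊛-vanish (⊖ a) (difference (scale-B k))))

-- At -z, the series z / (e^z - 1) becomes z e^z / (e^z - 1). Multiplied by e^z - 1, both `B⁺` and
-- `B⁻` give z e^z, and `pow-cancel` removes the factor.
B⁺-parity : ∀ n → B⁺ n ≡ pow (- 1ℚ) n * B n
B⁺-parity n = trans (lem (B⁺ n) (B⁻ n)) (trans (cong (_+ B⁻ n) (trans (D≐0 n) (const-0 n))) (ℚₚ.+-identityˡ (B⁻ n)))
  where
  lem : ∀ x y → x ≡ x + - y + y
  lem = solve-∀ ℚ-ring
  B⁻ = scale (- 1ℚ) B
  e⁻ = pow (- 1ℚ)
  inverse : e ⊛ e⁻ ≐ const 1ℚ
  inverse n = trans (sym (pow-+ 1ℚ (- 1ℚ) n)) (pow-0ℚ n)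
    where
    pow-0ℚ : pow 0ℚ ≐ const 1ℚ
    pow-0ℚ zero    = refl
    pow-0ℚ (suc n) = pow-0 {suc n} z<s
  D≐0 : B⁺ ⊕ ⊖ B⁻ ≐ 0ˢ
  D≐0 = pow-cancel 0 (B⁺ ⊕ ⊖ B⁻) (H.trans
    (HurwitzSolver.solve 5 (λ e e⁻ b b⁻ z → (e :+ :- con 1ℚ) :* (e :* b :+ :- b⁻)
       := e :* (e :* b :+ :- (b :+ z)) :+ :- b⁻ :* (e :* e⁻ :+ :- con 1ℚ)
          :+ e :* (e⁻ :* b⁻ :+ :- (b⁻ :+ con (- 1ℚ) :* z))) (λ _ → refl) e e⁻ B B⁻ Z)
    (⊕-vanish (⊕-vanish (⊛-vanish e (difference B⁺-def)) (⊛-vanish (⊖ B⁻) (difference inverse)))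
      (⊛-vanish e (difference (scale-B (- 1ℚ))))))

-- The substitution y = 1 - e^z.

-- On power series Σ aₖ yᵏ, θ is the derivation (y − 1) d/dy, which is d/dz when y = 1 − e^z; hence
-- τ a is the exponential generating function of Σ aₖ (1 − e^z)ᵏ.
θ : Seq → Seq
θ a k = ℕ→ℚ k * a k - ℕ→ℚ (suc k) * a (suc k)

τ : Seq → Seq
τ a zero    = a 0
τ a (suc n) = τ (θ a) n

shift : Seq → Seq
shift a zero    = 0ℚ
shift a (suc k) = a k

τ-cong : ∀ {a b} → a ≐ b → τ a ≐ τ b
τ-cong p zero    = p 0
τ-cong p (suc n) = τ-cong (λ k → cong₂ (λ x y → ℕ→ℚ k * x - ℕ→ℚ (suc k) * y) (p k) (p (suc k))) n

τ-⊕ : ∀ a b → τ (a ⊕ b) ≐ τ a ⊕ τ b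
τ-⊕ a b zero    = refl
τ-⊕ a b (suc n) = trans
  (τ-cong (λ k → lem (ℕ→ℚ k) (ℕ→ℚ (suc k)) (a k) (b k) (a (suc k)) (b (suc k))) n) (τ-⊕ (θ a) (θ b) n)
  where
  lem : ∀ k l x y x′ y′ → k * (x + y) - l * (x′ + y′) ≡ (k * x - l * x′) + (k * y - l * y′)
  lem = solve-∀ ℚ-ring

τ-· : ∀ c a → τ (c · a) ≐ c · τ a
τ-· c a zero    = refl
τ-· c a (suc n) = trans (τ-cong (λ k → lem c (ℕ→ℚ k) (ℕ→ℚ (suc k)) (a k) (a (suc k))) n) (τ-· c (θ a) n)
  where
  lem : ∀ c k l x y → k * (c * x) - l * (c * y) ≡ c * (k * x - l * y)
  lem = solve-∀ ℚ-ring

τ-const : ∀ c → τ (const c) ≐ const c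
τ-const c zero    = refl
τ-const c (suc n) = trans (τ-cong θ-const n) (τ-0 n)
  where
  θ-const : ∀ k → θ (const c) k ≡ 0ℚ
  θ-const zero    = lem c
    where
    lem : ∀ x → 0ℚ * x - 1ℚ * 0ℚ ≡ 0ℚ
    lem = solve-∀ ℚ-ring
  θ-const (suc k) = lem (ℕ→ℚ (suc k)) (ℕ→ℚ (suc (suc k)))
    where
    lem : ∀ x y → x * 0ℚ - y * 0ℚ ≡ 0ℚ
    lem = solve-∀ ℚ-ring
  τ-0 : ∀ n → τ (λ _ → 0ℚ) n ≡ 0ℚ
  τ-0 zero    = refl
  τ-0 (suc n) = trans (τ-cong (λ k → lem (ℕ→ℚ k) (ℕ→ℚ (suc k))) n) (τ-0 n)
    where
    lem : ∀ x y → x * 0ℚ - y * 0ℚ ≡ 0ℚ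
    lem = solve-∀ ℚ-ring

-- Multiplication by y becomes multiplication by 1 - e^z. The induction works because θ is a
-- derivation with θ y = y - 1, matching d/dz (1 - e^z) = -e^z.
τ-shift : ∀ a → τ (shift a) ≐ τ a ⊕ ⊖ (e ⊛ τ a)
τ-shift a zero    = lem (a 0)
  where
  lem : ∀ x → 0ℚ ≡ x + - (1ℚ * x)
  lem = solve-∀ ℚ-ring
τ-shift a (suc n) = begin
  τ (θ (shift a)) n
    ≡⟨ τ-cong θ-shift n ⟩
  τ (shift (θ a) ⊕ (shift a ⊕ (- 1ℚ) · a)) n
    ≡⟨ trans (τ-⊕ (shift (θ a)) (shift a ⊕ (- 1ℚ) · a) n)
         (cong (_+_ (τ (shift (θ a)) n)) (trans (τ-⊕ (shift a) ((- 1ℚ) · a) n) (cong (_+_ (τ (shift a) n)) (τ-· (- 1ℚ) a n)))) ⟩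
  τ (shift (θ a)) n + (τ (shift a) n + (- 1ℚ) * τ a n)
    ≡⟨ cong₂ (λ x y → x + (y + (- 1ℚ) * τ a n)) (τ-shift (θ a) n) (τ-shift a n) ⟩
  (τ (θ a) n + - (e ⊛ τ (θ a)) n) + ((τ a n + - (e ⊛ τ a) n) + (- 1ℚ) * τ a n)
    ≡⟨ lem (τ (θ a) n) ((e ⊛ τ (θ a)) n) (τ a n) ((e ⊛ τ a) n) ⟩
  τ (θ a) n + - ((1ℚ * (e ⊛ τ a) n) + (e ⊛ τ (θ a)) n)
    ≡⟨ cong (λ x → τ (θ a) n + - (x + (e ⊛ τ (θ a)) n)) (sym (·-⊛ 1ℚ e (τ a) n)) ⟩
  τ (θ a) n + - (((e ∘ suc) ⊛ τ a) n + (e ⊛ τ (θ a)) n) ∎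
  where
  open ≡-Reasoning
  lem : ∀ x y z w → (x + - y) + ((z + - w) + (- 1ℚ) * z) ≡ x + - (1ℚ * w + y)
  lem = solve-∀ ℚ-ring
  θ-shift : ∀ k → θ (shift a) k ≡ shift (θ a) k + (shift a k + (- 1ℚ) * a k)
  θ-shift zero    = alg (a 0)
    where
    alg : ∀ x → 0ℚ * 0ℚ - 1ℚ * x ≡ 0ℚ + (0ℚ + (- 1ℚ) * x)
    alg = solve-∀ ℚ-ring
  θ-shift (suc k) = trans
    (cong₂ (λ x y → x * a k - y * a (suc k)) (ℕ→ℚ-suc k) (ℕ→ℚ-suc (suc k)))
    (alg (ℕ→ℚ k) (ℕ→ℚ (suc k)) (a k) (a (suc k)))
    where
    alg : ∀ k l x y → (1ℚ + k) * x - (1ℚ + l) * y ≡ (k * x - l * y) + (x + (- 1ℚ) * y)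
    alg = solve-∀ ℚ-ring

-- The logarithmic series `F`, the dilogarithmic series `Q` and their coefficients.

coef : Seq
coef k = sign k * (leg3 (suc k) - leg3 (k ∸ 1))

coef-recurrence : ∀ k → coef (suc (suc (suc k))) ≡ coef (suc (suc k)) - coef (suc k)
coef-recurrence k = lem (sign k) (leg3 k) (leg3 (suc k)) (leg3 (suc (suc k)))
  where
  lem : ∀ s x y z → - - - s * (y - z) ≡ - - s * (x - y) - - s * (z - x)
  lem = solve-∀ ℚ-ring

logCoef dilogCoef : Seq
logCoef k   = coef k * inv k
dilogCoef k = coef k * inv k * inv k

ℕ→ℚ-inv-cancel : ∀ k x → ℕ→ℚ (suc k) * (x * inv (suc k)) ≡ x
ℕ→ℚ-inv-cancel k x = trans (lem (ℕ→ℚ (suc k)) x (inv (suc k))) (trans (cong (_* x) (inv-inverseˡ k)) (ℚₚ.*-identityˡ x))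
  where
  lem : ∀ k x i → k * (x * i) ≡ i * k * x
  lem = solve-∀ ℚ-ring

θ-logCoef-suc : ∀ k → θ logCoef (suc k) ≡ coef (suc k) - coef (suc (suc k))
θ-logCoef-suc k = cong₂ _-_ (ℕ→ℚ-inv-cancel k (coef (suc k))) (ℕ→ℚ-inv-cancel (suc k) (coef (suc (suc k))))

F Q : Seq
F = τ logCoef
Q = τ dilogCoef

-- For f = - log (1 - y + y²) one has (1 - y + y²) θ f = (y - 1)(1 - 2y) = -1 + 3y - 2y², which is
-- `series`. Applying `τ` substitutes y = 1 - e^z, under which 1 - y + y² becomes 1 - e^z + e^{2z}.
F-equation : (const 1ℚ ⊕ ⊖ e ⊕ e ⊛ e) ⊛ (F ∘ suc) ≐ e ⊕ ⊖ (const (ℕ→ℚ 2) ⊛ (e ⊛ e))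
F-equation = H.trans (H.sym lhs) (H.trans (τ-cong series) rhs)
  where
  g = θ logCoef
  r s : Seq
  r = g ⊕ ((- 1ℚ) · shift g ⊕ shift (shift g))
  s = const (- 1ℚ) ⊕ (ℕ→ℚ 3 · shift (const 1ℚ) ⊕ (- ℕ→ℚ 2) · shift (shift (const 1ℚ)))
  τ₃ : ∀ a b c x y → τ (a ⊕ (x · b ⊕ y · c)) ≐ τ a ⊕ (const x ⊛ τ b ⊕ const y ⊛ τ c)
  τ₃ a b c x y = H.trans (τ-⊕ a (x · b ⊕ y · c)) (H.+-cong (H.refl {τ a})
    (H.trans (τ-⊕ (x · b) (y · c)) (H.+-cong
      (H.trans (τ-· x b) (H.sym (const-⊛ x (τ b)))) (H.trans (τ-· y c) (H.sym (const-⊛ y (τ c)))))))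
  shifts : ∀ a → τ (shift (shift a)) ≐ (τ a ⊕ ⊖ (e ⊛ τ a)) ⊕ ⊖ (e ⊛ (τ a ⊕ ⊖ (e ⊛ τ a)))
  shifts a = H.trans (τ-shift (shift a)) (H.+-cong (τ-shift a) (H.-‿cong (⊛-cong {a = e} (λ _ → refl) (τ-shift a))))
  expand : ∀ a x y → const x ⊛ τ (shift a) ⊕ const y ⊛ τ (shift (shift a)) ≐
    const x ⊛ (τ a ⊕ ⊖ (e ⊛ τ a)) ⊕ const y ⊛ ((τ a ⊕ ⊖ (e ⊛ τ a)) ⊕ ⊖ (e ⊛ (τ a ⊕ ⊖ (e ⊛ τ a))))
  expand a x y = H.+-cong (⊛-cong {a = const x} (λ _ → refl) (τ-shift a)) (⊛-cong {a = const y} (λ _ → refl) (shifts a))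
  lhs : τ r ≐ (const 1ℚ ⊕ ⊖ e ⊕ e ⊛ e) ⊛ (F ∘ suc)
  lhs = H.trans (τ-cong {r} {g ⊕ ((- 1ℚ) · shift g ⊕ 1ℚ · shift (shift g))}
      (λ k → cong (λ x → g k + ((- 1ℚ) * shift g k + x)) (sym (ℚₚ.*-identityˡ (shift (shift g) k)))))
    (H.trans (τ₃ g (shift g) (shift (shift g)) (- 1ℚ) 1ℚ) (H.trans (H.+-cong (H.refl {τ g}) (expand g (- 1ℚ) 1ℚ))
      (HurwitzSolver.solve 2 (λ e G → G :+ (con (- 1ℚ) :* (G :+ :- (e :* G)) :+ con 1ℚ :* ((G :+ :- (e :* G)) :+ :- (e :* (G :+ :- (e :* G)))))
        := (con 1ℚ :+ :- e :+ e :* e) :* G) (λ _ → refl) e (τ g))))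
  rhs : τ s ≐ e ⊕ ⊖ (const (ℕ→ℚ 2) ⊛ (e ⊛ e))
  rhs = H.trans (τ₃ (const (- 1ℚ)) (shift (const 1ℚ)) (shift (shift (const 1ℚ))) (ℕ→ℚ 3) (- ℕ→ℚ 2))
    (H.trans (H.+-cong (τ-const (- 1ℚ)) (expand (const 1ℚ) (ℕ→ℚ 3) (- ℕ→ℚ 2)))
      (H.trans (H.+-cong (H.refl {const (- 1ℚ)}) (H.+-cong
          (⊛-cong {a = const (ℕ→ℚ 3)} (λ _ → refl) u) (⊛-cong {a = const (- ℕ→ℚ 2)} (λ _ → refl) (H.+-cong u (H.-‿cong (⊛-cong {a = e} (λ _ → refl) u))))))
        (HurwitzSolver.solve 1 (λ e → con (- 1ℚ) :+ (con (ℕ→ℚ 3) :* (con 1ℚ :+ :- (e :* con 1ℚ))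
            :+ con (- ℕ→ℚ 2) :* ((con 1ℚ :+ :- (e :* con 1ℚ)) :+ :- (e :* (con 1ℚ :+ :- (e :* con 1ℚ)))))
          := e :+ :- (con (ℕ→ℚ 2) :* (e :* e))) (λ _ → refl) e)))
    where
    u : τ (const 1ℚ) ⊕ ⊖ (e ⊛ τ (const 1ℚ)) ≐ const 1ℚ ⊕ ⊖ (e ⊛ const 1ℚ)
    u = H.+-cong (τ-const 1ℚ) (H.-‿cong (⊛-cong {a = e} (λ _ → refl) (τ-const 1ℚ)))
  series : r ≐ s
  series 0 = refl
  series 1 = refl
  series 2 = refl
  series (suc (suc (suc k))) = begin
    g (3+ k) + ((- 1ℚ) * g (suc (suc k)) + g (suc k))
      ≡⟨ cong₂ _+_ (θ-logCoef-suc (suc (suc k))) (cong₂ (λ x y → (- 1ℚ) * x + y) (θ-logCoef-suc (suc k)) (θ-logCoef-suc k)) ⟩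
    coef (3+ k) - coef (3+ suc k) + ((- 1ℚ) * (coef (suc (suc k)) - coef (3+ k)) + (coef (suc k) - coef (suc (suc k))))
      ≡⟨ cong (λ x → coef (3+ k) - x + ((- 1ℚ) * (coef (suc (suc k)) - coef (3+ k)) + (coef (suc k) - coef (suc (suc k))))) (coef-recurrence (suc k)) ⟩
    coef (3+ k) - (coef (3+ k) - coef (suc (suc k))) + ((- 1ℚ) * (coef (suc (suc k)) - coef (3+ k)) + (coef (suc k) - coef (suc (suc k))))
      ≡⟨ cong (λ x → x - (x - coef (suc (suc k))) + ((- 1ℚ) * (coef (suc (suc k)) - x) + (coef (suc k) - coef (suc (suc k))))) (coef-recurrence k) ⟩
    _ ≡⟨ lem (coef (suc (suc k))) (coef (suc k)) ⟩
    s (3+ k) ∎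
    where
    open ≡-Reasoning
    3+_ : ℕ → ℕ
    3+ n = suc (suc (suc n))
    lem : ∀ x y → (x - y) - ((x - y) - x) + ((- 1ℚ) * (x - (x - y)) + (y - x)) ≡ 0ℚ
    lem = solve-∀ ℚ-ring

-- For D = Σ c_k y^k / k² one has y θ D = (y - 1) f with f = Σ c_k y^k / k, which is `series`. At y
-- = 1 - e^z the factor (y - 1) / y is e^z / (e^z - 1), and z times it is `B⁺`.
Q-equation : Z ⊛ (Q ∘ suc) ≐ B⁺ ⊛ F
Q-equation = H.trans
  (HurwitzSolver.solve 5 (λ e b z q f → z :* q
     := e :* b :* f :+ :- b :* (q :+ :- (e :* q) :+ e :* f) :+ :- q :* (e :* b :+ :- (b :+ z))) (λ _ → refl) e B Z (Q ∘ suc) F)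
  (H.trans (H.+-cong (H.+-cong (H.refl {B⁺ ⊛ F}) (⊛-vanish (⊖ B) rel)) (⊛-vanish (⊖ (Q ∘ suc)) (difference B⁺-def)))
    (H.trans (H.+-identityʳ (B⁺ ⊛ F ⊕ 0ˢ)) (H.+-identityʳ (B⁺ ⊛ F))))
  where
  series : shift (θ dilogCoef) ≐ shift logCoef ⊕ (- 1ℚ) · logCoef
  series zero    = refl
  series (suc k) = trans (cong₂ _-_ (first k) (ℕ→ℚ-inv-cancel k (logCoef (suc k)))) (lem (logCoef k) (logCoef (suc k)))
    where
    first : ∀ k → ℕ→ℚ k * dilogCoef k ≡ logCoef k
    first zero    = refl
    first (suc k) = ℕ→ℚ-inv-cancel k (logCoef (suc k))
    lem : ∀ x y → x - y ≡ x + (- 1ℚ) * y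
    lem = solve-∀ ℚ-ring
  rel : (Q ∘ suc) ⊕ ⊖ (e ⊛ (Q ∘ suc)) ⊕ e ⊛ F ≐ 0ˢ
  rel n = begin
    Q (suc n) + - (e ⊛ (Q ∘ suc)) n + (e ⊛ F) n
      ≡⟨ cong (_+ (e ⊛ F) n) (sym (τ-shift (θ dilogCoef) n)) ⟩
    τ (shift (θ dilogCoef)) n + (e ⊛ F) n
      ≡⟨ cong (_+ (e ⊛ F) n) (trans (τ-cong series n) (trans (τ-⊕ (shift logCoef) ((- 1ℚ) · logCoef) n)
           (cong₂ _+_ (τ-shift logCoef n) (τ-· (- 1ℚ) logCoef n)))) ⟩
    F n + - (e ⊛ F) n + (- 1ℚ) * F n + (e ⊛ F) n
      ≡⟨ lem (F n) ((e ⊛ F) n) ⟩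
    0ℚ ≡⟨ const-0 n ⟨
    0ˢ n ∎
    where
    open ≡-Reasoning
    lem : ∀ x y → x + - y + (- 1ℚ) * x + y ≡ 0ℚ
    lem = solve-∀ ℚ-ring

-- Expanded, 6^n - 3^n - 2^n + 1: one signed power for each factor e^{cz} - 1 of the quotient, c =
-- 6, 3, 2, 1.
γ : ℕ → ℚ
γ n = (pow (ℕ→ℚ 3) n - 1ℚ) * (pow (ℕ→ℚ 2) n - 1ℚ)

-- The coefficient at n + 1 of the series shown to vanish by `log-derivative`: e^{cz} · c z /
-- (e^{cz} - 1) is `B⁺` at c z, so its coefficients are c^m B⁺_m.
F-suc : ∀ n → ℕ→ℚ (suc n) * F (suc n) ≡ - (γ (suc n) * B⁺ (suc n))
F-suc n = begin
  ℕ→ℚ (suc n) * F (suc n)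
    ≡⟨ Z-⊛-suc (F ∘ suc) n ⟨
  (Z ⊛ (F ∘ suc)) m
    ≡⟨ lem ((Z ⊛ (F ∘ suc)) m) _ _ _ _ ⟩
  W m - (((x³ ⊛ x³ ⊛ b 6) m) + (e ⊛ b 1) m - (e ⊛ e ⊛ b 2) m - (x³ ⊛ b 3) m)
    ≡⟨ cong₂ (λ x y → x - y) (W≐0 m) (cong₂ (λ x y → x - y) (cong₂ (λ x y → x - y)
         (cong₂ _+_ (scaled 6 (⊛-cong pow3 pow3 ⟫ H.sym (pow-+ (ℕ→ℚ 3) (ℕ→ℚ 3)))) (scaled 1 (λ _ → refl)))
         (scaled 2 (H.sym (pow-+ 1ℚ 1ℚ)))) (scaled 3 pow3)) ⟩
  0ℚ - (P 6 * B⁺ m + P 1 * B⁺ m - P 2 * B⁺ m - P 3 * B⁺ m)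
    ≡⟨ cong₂ (λ x y → 0ℚ - (x * B⁺ m + y * B⁺ m - P 2 * B⁺ m - P 3 * B⁺ m)) (pow-distrib (ℕ→ℚ 3) (ℕ→ℚ 2) m) (e≡1 m) ⟩
  0ℚ - (P 3 * P 2 * B⁺ m + 1ℚ * B⁺ m - P 2 * B⁺ m - P 3 * B⁺ m)
    ≡⟨ alg (P 3) (P 2) (B⁺ m) ⟩
  - (γ m * B⁺ m) ∎
  where
  open ≡-Reasoning
  m = suc n
  b : ℕ → Seq
  b c = scale (ℕ→ℚ c) B
  P : ℕ → ℚ
  P c = pow (ℕ→ℚ c) m
  x³ W : Seq
  x³ = e ⊛ e ⊛ e
  W = Z ⊛ (F ∘ suc) ⊕ x³ ⊛ x³ ⊛ b 6 ⊕ e ⊛ b 1 ⊕ ⊖ (e ⊛ e ⊛ b 2) ⊕ ⊖ (x³ ⊛ b 3)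
  _⟫_ : ∀ {x y z} → x ≐ y → y ≐ z → x ≐ z
  _⟫_ = H.trans
  pow3 : x³ ≐ pow (ℕ→ℚ 3)
  pow3 = ⊛-cong (H.sym (pow-+ 1ℚ 1ℚ)) (H.refl {e}) ⟫ H.sym (pow-+ (ℕ→ℚ 2) 1ℚ)
  hyp : ∀ c {x} → x ≐ pow (ℕ→ℚ c) → x ⊛ b c ≐ b c ⊕ const (ℕ→ℚ c) ⊛ Z
  hyp c p = ⊛-cong p (H.refl {b c}) ⟫ scale-B (ℕ→ℚ c)
  pow6 : x³ ⊛ x³ ≐ pow (ℕ→ℚ 6)
  pow6 = ⊛-cong pow3 pow3 ⟫ H.sym (pow-+ (ℕ→ℚ 3) (ℕ→ℚ 3))
  W≐0 : ∀ m → W m ≡ 0ˢ m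
  W≐0 = pow-cancel 5 W (⊛-cong (H.+-cong (H.sym pow6) (H.refl {⊖ const 1ℚ})) (H.refl {W}) ⟫
    log-derivative e Z (F ∘ suc) (b 1) (b 2) (b 3) (b 6) F-equation
      (hyp 1 (H.refl {e})) (hyp 2 (H.sym (pow-+ 1ℚ 1ℚ))) (hyp 3 pow3) (hyp 6 pow6))
  scaled : ∀ c {x} → x ≐ pow (ℕ→ℚ c) → (x ⊛ b c) m ≡ P c * B⁺ m
  scaled c p = trans (⊛-cong (p ⟫ H.sym (scale-e (ℕ→ℚ c))) (H.refl {b c}) m) (sym (scale-⊛ (ℕ→ℚ c) e B m))
  lem : ∀ z x₆ x₁ x₂ x₃ → z ≡ (z + x₆ + x₁ + - x₂ + - x₃) - (x₆ + x₁ - x₂ - x₃)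
  lem = solve-∀ ℚ-ring
  alg : ∀ x y b → 0ℚ - (x * y * b + 1ℚ * b - y * b - x * b) ≡ - ((x - 1ℚ) * (y - 1ℚ) * b)
  alg = solve-∀ ℚ-ring

F-closed : ∀ n → F (suc n) ≡ - (γ (suc n) * B⁺ (suc n) * inv (suc n))
F-closed n = ℕ→ℚ-cancelˡ n (trans (F-suc n) (trans (cong -_ (sym (ℕ→ℚ-inv-cancel n (γ (suc n) * B⁺ (suc n)))))
  (lem (ℕ→ℚ (suc n)) (γ (suc n) * B⁺ (suc n) * inv (suc n)))))
  where
  lem : ∀ x y → - (x * y) ≡ x * - y
  lem = solve-∀ ℚ-ring

Q-binomial : ∀ n → ℕ→ℚ (suc n) * Q (suc n) ≡ ∑ (suc n) (λ r → ℕ→ℚ (suc n C r) * B⁺ r * F (suc n ∸ r))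
Q-binomial n = begin
  ℕ→ℚ (suc n) * Q (suc n)      ≡⟨ Z-⊛-suc (Q ∘ suc) n ⟨
  (Z ⊛ (Q ∘ suc)) (suc n)      ≡⟨ Q-equation (suc n) ⟩
  (B⁺ ⊛ F) (suc n)             ≡⟨ ⊛-binomial B⁺ F (suc n) ⟩
  ∑ (suc (suc n)) t            ≡⟨ ∑-last (suc n) t ⟩
  ∑ (suc n) t + t (suc n)
    -- The term r = n + 1 drops out because `F 0` = 0.
    ≡⟨ cong (λ m → ∑ (suc n) t + ℕ→ℚ (suc n C suc n) * B⁺ (suc n) * F m) (ℕₚ.n∸n≡0 n) ⟩
  ∑ (suc n) t + ℕ→ℚ (suc n C suc n) * B⁺ (suc n) * 0ℚ
    ≡⟨ lem (∑ (suc n) t) (ℕ→ℚ (suc n C suc n) * B⁺ (suc n)) ⟩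
  ∑ (suc n) t                  ∎
  where
  open ≡-Reasoning
  t : ℕ → ℚ
  t r = ℕ→ℚ (suc n C r) * B⁺ r * F (suc n ∸ r)
  lem : ∀ x y → x + y * 0ℚ ≡ x
  lem = solve-∀ ℚ-ring

B⁺≡B : ∀ n → B⁺ (suc (suc n)) ≡ B (suc (suc n))
B⁺≡B n = trans (B⁺-def (suc (suc n))) (ℚₚ.+-identityʳ (B (suc (suc n))))

-- Modulo the terms ½ Z of B⁺ and − Z of F, both series are even, so their product is even too.
Q-odd : ∀ m → let M = suc (suc m) in pow (- 1ℚ) M ≡ 1ℚ → Q (suc M) ≡ ½ * F M - B M
Q-odd m M-even = ℕ→ℚ-cancelˡ M (begin
  ℕ→ℚ (suc M) * Q (suc M)
    ≡⟨ Z-⊛-suc (Q ∘ suc) M ⟨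
  (Z ⊛ (Q ∘ suc)) (suc M)
    ≡⟨ Q-equation (suc M) ⟩
  (B⁺ ⊛ F) (suc M)
    ≡⟨ HurwitzSolver.solve 3 (λ b f z → b :* f := (b :+ :- (con ½ :* z)) :* (f :+ z)
         :+ (con ½ :* (z :* (f :+ z)) :+ :- (z :* b))) (λ _ → refl) B⁺ F Z (suc M) ⟩
  (h ⊛ k) (suc M) + ((const ½ ⊛ (Z ⊛ k)) (suc M) + - (Z ⊛ B⁺) (suc M))
    ≡⟨ cong₂ _+_ hk≡0 (cong₂ (λ x y → x + - y) (trans (const-⊛ ½ (Z ⊛ k) (suc M)) (cong (½ *_) (Z-⊛-suc k M))) (Z-⊛-suc B⁺ M)) ⟩
  0ℚ + (½ * (ℕ→ℚ (suc M) * (F M + 0ℚ)) + - (ℕ→ℚ (suc M) * B⁺ M))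
    ≡⟨ cong (λ x → 0ℚ + (½ * (ℕ→ℚ (suc M) * (F M + 0ℚ)) + - (ℕ→ℚ (suc M) * x))) (B⁺≡B m) ⟩
  0ℚ + (½ * (ℕ→ℚ (suc M) * (F M + 0ℚ)) + - (ℕ→ℚ (suc M) * B M))
    ≡⟨ lem ½ (ℕ→ℚ (suc M)) (F M) (B M) ⟩
  ℕ→ℚ (suc M) * (½ * F M - B M) ∎)
  where
  open ≡-Reasoning
  M = suc (suc m)
  h k : Seq
  h = B⁺ ⊕ ⊖ (const ½ ⊛ Z)
  k = F ⊕ Z
  lem : ∀ c n f b → 0ℚ + (c * (n * (f + 0ℚ)) + - (n * b)) ≡ n * (c * f - b)
  lem = solve-∀ ℚ-ring
  B⁺-even : ∀ n → pow (- 1ℚ) (suc (suc n)) * B⁺ (suc (suc n)) ≡ B⁺ (suc (suc n))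
  B⁺-even n = trans (cong (pow (- 1ℚ) (suc (suc n)) *_) (B⁺≡B n)) (sym (B⁺-parity (suc (suc n))))
  h-even : scale (- 1ℚ) h ≐ h
  h-even 0 = refl
  h-even 1 = refl
  h-even (suc (suc n)) = trans (cong (pow (- 1ℚ) (suc (suc n)) *_) (h≡ n)) (trans (B⁺-even n) (sym (h≡ n)))
    where
    h≡ : ∀ n → h (suc (suc n)) ≡ B⁺ (suc (suc n))
    h≡ n = trans (cong (λ x → B⁺ (suc (suc n)) + - x) (const-⊛ ½ Z (suc (suc n)))) (ℚₚ.+-identityʳ (B⁺ (suc (suc n))))
  k-even : scale (- 1ℚ) k ≐ k
  k-even 0 = refl
  k-even 1 = refl
  k-even (suc (suc n)) = begin
    s * (F N + 0ℚ)                      ≡⟨ cong (λ x → s * (x + 0ℚ)) (F-closed (suc n)) ⟩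
    s * (- (γ N * B⁺ N * inv N) + 0ℚ)   ≡⟨ alg s (γ N) (B⁺ N) (inv N) ⟩
    - (γ N * (s * B⁺ N) * inv N) + 0ℚ   ≡⟨ cong (λ x → - (γ N * x * inv N) + 0ℚ) (B⁺-even n) ⟩
    - (γ N * B⁺ N * inv N) + 0ℚ         ≡⟨ cong (_+ 0ℚ) (F-closed (suc n)) ⟨
    F N + 0ℚ                            ∎
    where
    N = suc (suc n)
    s = pow (- 1ℚ) N
    alg : ∀ s g b i → s * (- (g * b * i) + 0ℚ) ≡ - (g * (s * b) * i) + 0ℚ
    alg = solve-∀ ℚ-ring
  hk≡0 : (h ⊛ k) (suc M) ≡ 0ℚ
  hk≡0 = begin
    x                                ≡⟨ alg x ⟩
    ½ * (x - (- 1ℚ) * 1ℚ * x)        ≡⟨ cong (λ s → ½ * (x - (- 1ℚ) * s * x)) (sym M-even) ⟩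
    ½ * (x - pow (- 1ℚ) (suc M) * x) ≡⟨ cong (λ y → ½ * (x - y)) (trans (scale-⊛ (- 1ℚ) h k (suc M)) (⊛-cong h-even k-even (suc M))) ⟩
    ½ * (x - x)                      ≡⟨ cong (½ *_) (ℚₚ.+-inverseʳ x) ⟩
    ½ * 0ℚ                           ≡⟨⟩
    0ℚ                               ∎
    where
    x = (h ⊛ k) (suc M)
    alg : ∀ x → x ≡ ½ * (x - (- 1ℚ) * 1ℚ * x)
    alg = solve-∀ ℚ-ring

-- Finite differences and the coefficients of (1 - e^z)^k.

δ : Seq → Seq
δ g i = g i - g (suc i)

-- This is (1 - E)^k with E the shift of the index. The sign of `δ` is chosen so that i ↦ e^{iz} is
-- sent to (1 - e^z)^k at i = 0.
Δ : ℕ → Seq → Seq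
Δ zero    g = g
Δ (suc k) g = δ (Δ k g)

-- T k n is n! times the coefficient of zⁿ in (1 − e^z)ᵏ, i.e. (−1)ᵏ k! times a Stirling number S(n, k).
T : ℕ → ℕ → ℚ
T k n = Δ k (λ i → pow (ℕ→ℚ i) n) 0

-- Commutation of (1 - E)^{k+1} with multiplication by the index i: one factor gives (1 - E) i = i
-- (1 - E) - E, and each further factor contributes another E.
Δ-index : ∀ k g i →
  Δ (suc k) (λ j → ℕ→ℚ j * g j) i ≡ ℕ→ℚ i * Δ (suc k) g i - ℕ→ℚ (suc k) * Δ k g (suc i)
Δ-index zero g i = trans (cong (λ x → ℕ→ℚ i * g i - x * g (suc i)) (ℕ→ℚ-suc i)) (lem (ℕ→ℚ i) (g i) (g (suc i)))
  where
  lem : ∀ n x y → n * x - (1ℚ + n) * y ≡ n * (x - y) - 1ℚ * y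
  lem = solve-∀ ℚ-ring
Δ-index (suc k) g i = begin
  Δ (suc k) (λ j → ℕ→ℚ j * g j) i - Δ (suc k) (λ j → ℕ→ℚ j * g j) (suc i)
    ≡⟨ cong₂ _-_ (Δ-index k g i) (Δ-index k g (suc i)) ⟩
  (ℕ→ℚ i * a - K * c) - (ℕ→ℚ (suc i) * b - K * d)
    ≡⟨ cong (λ x → (ℕ→ℚ i * a - K * c) - (x * b - K * d)) (ℕ→ℚ-suc i) ⟩
  (ℕ→ℚ i * a - K * c) - ((1ℚ + ℕ→ℚ i) * (c - d) - K * d)
    ≡⟨ lem (ℕ→ℚ i) a c d K ⟩
  ℕ→ℚ i * (a - (c - d)) - (1ℚ + K) * (c - d)
    ≡⟨ cong (λ x → ℕ→ℚ i * (a - b) - x * b) (ℕ→ℚ-suc (suc k)) ⟨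
  ℕ→ℚ i * (a - b) - ℕ→ℚ (suc (suc k)) * b ∎
  where
  open ≡-Reasoning
  a = Δ (suc k) g i
  b = Δ (suc k) g (suc i)
  c = Δ k g (suc i)
  d = Δ k g (suc (suc i))
  K = ℕ→ℚ (suc k)
  lem : ∀ n a c d K → (n * a - K * c) - ((1ℚ + n) * (c - d) - K * d) ≡ n * (a - (c - d)) - (1ℚ + K) * (c - d)
  lem = solve-∀ ℚ-ring

-- The derivative of (1 - e^z)^{k+1} is (k + 1)(-e^z)(1 - e^z)^k, and -e^z = (1 - e^z) - 1.
T-recurrence : ∀ k n → T (suc k) (suc n) ≡ ℕ→ℚ (suc k) * (T (suc k) n - T k n)
T-recurrence k n = trans (Δ-index k g 0) (lem (Δ (suc k) g 0) (ℕ→ℚ (suc k)) (Δ k g 0) (Δ k g 1))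
  where
  g : Seq
  g i = pow (ℕ→ℚ i) n
  lem : ∀ x K u v → 0ℚ * x - K * v ≡ K * ((u - v) - u)
  lem = solve-∀ ℚ-ring

T-zero-suc : ∀ n → T 0 (suc n) ≡ 0ℚ
T-zero-suc n = pow-0 {suc n} z<s

T-suc-zero : ∀ k → T (suc k) 0 ≡ 0ℚ
T-suc-zero k = vanish k 0
  where
  vanish : ∀ k i → Δ (suc k) (λ _ → 1ℚ) i ≡ 0ℚ
  vanish zero    i = refl
  vanish (suc k) i = cong₂ _-_ (vanish k i) (vanish k (suc i))

T-vanish : ∀ {k n} → n ℕ.< k → T k n ≡ 0ℚ
T-vanish {suc k} {zero}  _         = T-suc-zero k
T-vanish {suc k} {suc n} (s≤s n<k) = trans (T-recurrence k n) (trans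
  (cong₂ (λ x y → ℕ→ℚ (suc k) * (x - y)) (T-vanish {suc k} {n} (ℕₚ.m<n⇒m<1+n n<k)) (T-vanish n<k))
  (ℚₚ.*-zeroʳ (ℕ→ℚ (suc k))))

∑-minus : ∀ n f g → ∑ n (λ i → f i - g i) ≡ ∑ n f - ∑ n g
∑-minus zero    f g = refl
∑-minus (suc n) f g = trans (cong (_+_ (f 0 - g 0)) (∑-minus n (f ∘ suc) (g ∘ suc)))
  (lem (f 0) (g 0) (∑ n (f ∘ suc)) (∑ n (g ∘ suc)))
  where
  lem : ∀ a b c d → (a - b) + (c - d) ≡ (a + c) - (b + d)
  lem = solve-∀ ℚ-ring

-- Summation by parts: `θ` on the coefficients is transposed into the recurrence of `T`, and
-- `T-vanish` kills the boundary term. The bound m is left free so that one range of summation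
-- serves every n ≤ p - 1.
τ-sum : ∀ {n m} → n ℕ.≤ m → ∀ a → τ a n ≡ ∑ (suc m) (λ k → a k * T k n)
τ-sum {zero} {m} _ a = sym (trans (cong₂ _+_ (ℚₚ.*-identityʳ (a 0))
  (∑-0 m (λ i _ → trans (cong (a (suc i) *_) (T-suc-zero i)) (ℚₚ.*-zeroʳ (a (suc i)))))) (ℚₚ.+-identityʳ (a 0)))
τ-sum {suc n} {m} n<m a = begin
  τ (θ a) n
    ≡⟨ τ-sum (ℕₚ.<⇒≤ n<m) (θ a) ⟩
  ∑ (suc m) (λ k → θ a k * T k n)
    ≡⟨ ∑-cong (suc m) (λ k _ → lem₁ (ℕ→ℚ k) (a k) (ℕ→ℚ (suc k)) (a (suc k)) (T k n)) ⟩
  ∑ (suc m) (λ k → f k - g k)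
    ≡⟨ ∑-minus (suc m) f g ⟩
  f 0 + ∑ m (f ∘ suc) - ∑ (suc m) g
    ≡⟨ cong (λ x → f 0 + ∑ m (f ∘ suc) - x) (∑-last m g) ⟩
  f 0 + ∑ m (f ∘ suc) - (∑ m g + ℕ→ℚ (suc m) * a (suc m) * T m n)
    ≡⟨ cong (λ x → f 0 + ∑ m (f ∘ suc) - (∑ m g + ℕ→ℚ (suc m) * a (suc m) * x)) (T-vanish n<m) ⟩
  0ℚ * a 0 * T 0 n + ∑ m (f ∘ suc) - (∑ m g + ℕ→ℚ (suc m) * a (suc m) * 0ℚ)
    ≡⟨ lem₂ (a 0) (T 0 n) (∑ m (f ∘ suc)) (∑ m g) (ℕ→ℚ (suc m)) (a (suc m)) ⟩
  a 0 * 0ℚ + (∑ m (f ∘ suc) - ∑ m g)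
    ≡⟨ cong₂ (λ x y → a 0 * x + y) (T-zero-suc n) (∑-minus m (f ∘ suc) g) ⟨
  a 0 * T 0 (suc n) + ∑ m (λ k → f (suc k) - g k)
    ≡⟨ cong (_+_ (a 0 * T 0 (suc n))) (∑-cong m (λ k _ → trans
         (lem₃ (ℕ→ℚ (suc k)) (a (suc k)) (T (suc k) n) (T k n)) (cong (a (suc k) *_) (sym (T-recurrence k n))))) ⟩
  ∑ (suc m) (λ k → a k * T k (suc n)) ∎
  where
  open ≡-Reasoning
  f g : ℕ → ℚ
  f k = ℕ→ℚ k * a k * T k n
  g k = ℕ→ℚ (suc k) * a (suc k) * T k n
  lem₁ : ∀ k x l y t → (k * x - l * y) * t ≡ k * x * t - l * y * t
  lem₁ = solve-∀ ℚ-ring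
  lem₂ : ∀ x t s u k y → 0ℚ * x * t + s - (u + k * y * 0ℚ) ≡ x * 0ℚ + (s - u)
  lem₂ = solve-∀ ℚ-ring
  lem₃ : ∀ k x t u → k * x * t - k * x * u ≡ x * (k * (t - u))
  lem₃ = solve-∀ ℚ-ring

-- Powers of ℓ = - log (1 - y): `L j s` is the coefficient of y^s in ℓ^j.

L : ℕ → ℕ → ℚ
L j s = sumℚ (map prodInv (compositions j s))

sumℚ-++ : ∀ xs ys → sumℚ (xs ++ ys) ≡ sumℚ xs + sumℚ ys
sumℚ-++ []       ys = sym (ℚₚ.+-identityˡ (sumℚ ys))
sumℚ-++ (x ∷ xs) ys = trans (cong (_+_ x) (sumℚ-++ xs ys)) (sym (ℚₚ.+-assoc x (sumℚ xs) (sumℚ ys)))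

sumℚ-concatMap : ∀ {A : Set} (w : A → ℚ) (f : ℕ → List A) n g →
  sumℚ (map w (concatMap f (applyUpTo g n))) ≡ ∑ n (λ i → sumℚ (map w (f (g i))))
sumℚ-concatMap w f zero    g = refl
sumℚ-concatMap w f (suc n) g = trans (cong sumℚ (Listₚ.map-++ w (f (g 0)) (concatMap f (applyUpTo (g ∘ suc) n))))
  (trans (sumℚ-++ (map w (f (g 0))) (map w (concatMap f (applyUpTo (g ∘ suc) n))))
    (cong (_+_ (sumℚ (map w (f (g 0))))) (sumℚ-concatMap w f n (g ∘ suc))))

sumℚ-map-∷ : ∀ {j} (w : Vec ℕ (suc j) → ℚ) c k → (∀ v → w (k ∷ v) ≡ c * prodInv v) →
  ∀ vs → sumℚ (map w (map (k ∷_) vs)) ≡ c * sumℚ (map prodInv vs)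
sumℚ-map-∷ w c k w≡ []       = sym (ℚₚ.*-zeroʳ c)
sumℚ-map-∷ w c k w≡ (v ∷ vs) = trans (cong₂ _+_ (w≡ v) (sumℚ-map-∷ w c k w≡ vs))
  (sym (ℚₚ.*-distribˡ-+ c (prodInv v) (sumℚ (map prodInv vs))))

L-suc : ∀ j s → L (suc j) s ≡ ∑ s (λ i → inv (suc i) * L j (s ∸ suc i))
L-suc j s = trans (sumℚ-concatMap prodInv (λ i → map (suc i ∷_) (compositions j (s ∸ suc i))) s id)
  (∑-cong s (λ i _ → sumℚ-map-∷ prodInv (inv (suc i)) (suc i) (λ _ → refl) (compositions j (s ∸ suc i))))

LHS-suc : ∀ j s → LHS (suc j) s ≡ ∑ s (λ i → logCoef (suc i) * L j (s ∸ suc i))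
LHS-suc j s = trans (sumℚ-concatMap summand (λ i → map (suc i ∷_) (compositions j (s ∸ suc i))) s id)
  (∑-cong s (λ i _ → sumℚ-map-∷ summand (logCoef (suc i)) (suc i)
    (λ v → sym (ℚₚ.*-assoc (coef (suc i)) (inv (suc i)) (prodInv v))) (compositions j (s ∸ suc i))))

L-1 : ∀ s → L 1 (suc s) ≡ inv (suc s)
L-1 s = trans (L-suc 0 (suc s)) (trans (∑-last s f) (trans (cong₂ _+_ (∑-0 s early) last) (ℚₚ.+-identityˡ (inv (suc s)))))
  where
  f : ℕ → ℚ
  f i = inv (suc i) * L 0 (s ∸ i)
  L-0-suc : ∀ m → 0 ℕ.< m → L 0 m ≡ 0ℚ
  L-0-suc (suc m) _ = refl
  early : ∀ i → i ℕ.< s → f i ≡ 0ℚ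
  early i i<s = trans (cong (inv (suc i) *_) (L-0-suc (s ∸ i) (ℕₚ.m<n⇒0<n∸m i<s))) (ℚₚ.*-zeroʳ (inv (suc i)))
  last : f s ≡ inv (suc s)
  last = trans (cong (λ m → inv (suc s) * L 0 m) (ℕₚ.n∸n≡0 s)) (ℚₚ.*-identityʳ (inv (suc s)))

∑-reverse : ∀ n f → ∑ n (λ i → f (n ∸ suc i)) ≡ ∑ n f
∑-reverse zero    f = refl
∑-reverse (suc n) f = trans (cong (_+_ (f n)) (∑-reverse n f)) (trans (ℚₚ.+-comm (f n) (∑ n f)) (sym (∑-last n f)))

-- The Leibniz rule for y d/dy (ℓ · ℓ^j): the weight s splits into the first part, which cancels its
-- own reciprocal, and the sum of the other parts.
L-weighted : ∀ j s → ℕ→ℚ s * L (suc j) s ≡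
  ∑ s (L j) + ∑ s (λ i → inv (suc i) * (ℕ→ℚ (s ∸ suc i) * L j (s ∸ suc i)))
L-weighted j s = begin
  ℕ→ℚ s * L (suc j) s
    ≡⟨ cong (ℕ→ℚ s *_) (L-suc j s) ⟩
  ℕ→ℚ s * ∑ s f
    ≡⟨ ∑-*ˡ s (ℕ→ℚ s) f ⟨
  ∑ s (λ i → ℕ→ℚ s * f i)
    ≡⟨ ∑-cong s split ⟩
  ∑ s (λ i → L j (s ∸ suc i) + g i)
    ≡⟨ ∑-+ s (λ i → L j (s ∸ suc i)) g ⟩
  ∑ s (λ i → L j (s ∸ suc i)) + ∑ s g
    ≡⟨ cong (_+ ∑ s g) (∑-reverse s (L j)) ⟩
  ∑ s (L j) + ∑ s g ∎
  where
  open ≡-Reasoning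
  f g : ℕ → ℚ
  f i = inv (suc i) * L j (s ∸ suc i)
  g i = inv (suc i) * (ℕ→ℚ (s ∸ suc i) * L j (s ∸ suc i))
  split : ∀ i → i ℕ.< s → ℕ→ℚ s * f i ≡ L j (s ∸ suc i) + g i
  split i i<s = begin
    ℕ→ℚ s * f i
      ≡⟨ cong (λ m → ℕ→ℚ m * f i) (sym (ℕₚ.m+[n∸m]≡n i<s)) ⟩
    ℕ→ℚ (suc i ℕ.+ (s ∸ suc i)) * f i
      ≡⟨ cong (_* f i) (ℕ→ℚ-+ (suc i) (s ∸ suc i)) ⟩
    (ℕ→ℚ (suc i) + ℕ→ℚ (s ∸ suc i)) * f i
      ≡⟨ lem (ℕ→ℚ (suc i)) (ℕ→ℚ (s ∸ suc i)) (inv (suc i)) (L j (s ∸ suc i)) ⟩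
    inv (suc i) * ℕ→ℚ (suc i) * L j (s ∸ suc i) + g i
      ≡⟨ cong (λ x → x * L j (s ∸ suc i) + g i) (inv-inverseˡ i) ⟩
    1ℚ * L j (s ∸ suc i) + g i
      ≡⟨ cong (_+ g i) (ℚₚ.*-identityˡ (L j (s ∸ suc i))) ⟩
    L j (s ∸ suc i) + g i ∎
    where
    lem : ∀ a b c d → (a + b) * (c * d) ≡ c * a * d + c * (b * d)
    lem = solve-∀ ℚ-ring

-- The coefficientwise form of (1 − y) d/dy ℓ^{j+1} = (j + 1) ℓ^j for ℓ = − log (1 − y).
L-derivative : ∀ j m → ℕ→ℚ (suc m) * L (suc j) (suc m) - ℕ→ℚ m * L (suc j) m ≡ ℕ→ℚ (suc j) * L j m
L-derivative j m = begin
  ℕ→ℚ (suc m) * L (suc j) (suc m) - ℕ→ℚ m * L (suc j) m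
    ≡⟨ cong₂ _-_ (L-weighted j (suc m)) (L-weighted j m) ⟩
  (∑ (suc m) (L j) + ∑ (suc m) g) - (∑ m (L j) + ∑ m f)
    ≡⟨ cong₂ (λ x y → (x + y) - (∑ m (L j) + ∑ m f)) (∑-last m (L j)) (trans (∑-last m g)
         (cong (_+_ (∑ m g)) (trans (cong (λ k → inv (suc m) * (ℕ→ℚ k * L j k)) (ℕₚ.n∸n≡0 m)) (zero′ (inv (suc m)) (L j 0))))) ⟩
  (∑ m (L j) + L j m + (∑ m g + 0ℚ)) - (∑ m (L j) + ∑ m f)
    ≡⟨ lem (∑ m (L j)) (L j m) (∑ m g) (∑ m f) ⟩
  L j m + (∑ m g - ∑ m f)
    ≡⟨ cong (_+_ (L j m)) (sym (∑-minus m g f)) ⟩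
  L j m + ∑ m (λ i → g i - f i)
    ≡⟨ step j ⟩
  ℕ→ℚ (suc j) * L j m ∎
  where
  open ≡-Reasoning
  f g : ℕ → ℚ
  f i = inv (suc i) * (ℕ→ℚ (m ∸ suc i) * L j (m ∸ suc i))
  g i = inv (suc i) * (ℕ→ℚ (m ∸ i) * L j (m ∸ i))
  zero′ : ∀ x y → x * (0ℚ * y) ≡ 0ℚ
  zero′ = solve-∀ ℚ-ring
  lem : ∀ a b c d → (a + b + (c + 0ℚ)) - (a + d) ≡ b + (c - d)
  lem = solve-∀ ℚ-ring
  step : ∀ j → L j m + ∑ m (λ i → inv (suc i) * (ℕ→ℚ (m ∸ i) * L j (m ∸ i))
    - inv (suc i) * (ℕ→ℚ (m ∸ suc i) * L j (m ∸ suc i))) ≡ ℕ→ℚ (suc j) * L j m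
  step zero = trans (cong (_+_ (L 0 m)) (∑-0 m (λ i _ → trans
    (cong₂ (λ x y → inv (suc i) * x - inv (suc i) * y) (L-0 (m ∸ i)) (L-0 (m ∸ suc i))) (alg (inv (suc i))))))
    (trans (ℚₚ.+-identityʳ (L 0 m)) (sym (ℚₚ.*-identityˡ (L 0 m))))
    where
    L-0 : ∀ s → ℕ→ℚ s * L 0 s ≡ 0ℚ
    L-0 zero    = refl
    L-0 (suc s) = ℚₚ.*-zeroʳ (ℕ→ℚ (suc s))
    alg : ∀ x → x * 0ℚ - x * 0ℚ ≡ 0ℚ
    alg = solve-∀ ℚ-ring
  -- The consecutive differences inside the sum are `L-derivative` for j, so the induction runs on
  -- the number of parts.
  step (suc j) = begin
    L (suc j) m + ∑ m (λ i → inv (suc i) * (ℕ→ℚ (m ∸ i) * L (suc j) (m ∸ i)) - inv (suc i) * (ℕ→ℚ (m ∸ suc i) * L (suc j) (m ∸ suc i)))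
      ≡⟨ cong (_+_ (L (suc j) m)) (∑-cong m term) ⟩
    L (suc j) m + ∑ m (λ i → ℕ→ℚ (suc j) * (inv (suc i) * L j (m ∸ suc i)))
      ≡⟨ cong (_+_ (L (suc j) m)) (trans (∑-*ˡ m (ℕ→ℚ (suc j)) _) (cong (ℕ→ℚ (suc j) *_) (sym (L-suc j m)))) ⟩
    L (suc j) m + ℕ→ℚ (suc j) * L (suc j) m
      ≡⟨ alg (L (suc j) m) (ℕ→ℚ (suc j)) ⟩
    (1ℚ + ℕ→ℚ (suc j)) * L (suc j) m
      ≡⟨ cong (_* L (suc j) m) (ℕ→ℚ-suc (suc j)) ⟨
    ℕ→ℚ (suc (suc j)) * L (suc j) m ∎
    where
    alg : ∀ x y → x + y * x ≡ (1ℚ + y) * x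
    alg = solve-∀ ℚ-ring
    alg′ : ∀ i x y → i * x - i * y ≡ i * (x - y)
    alg′ = solve-∀ ℚ-ring
    alg″ : ∀ i x y → i * (x * y) ≡ x * (i * y)
    alg″ = solve-∀ ℚ-ring
    term : ∀ i → i ℕ.< m → inv (suc i) * (ℕ→ℚ (m ∸ i) * L (suc j) (m ∸ i)) - inv (suc i) * (ℕ→ℚ (m ∸ suc i) * L (suc j) (m ∸ suc i))
      ≡ ℕ→ℚ (suc j) * (inv (suc i) * L j (m ∸ suc i))
    term i i<m = begin
      inv (suc i) * (ℕ→ℚ (m ∸ i) * L (suc j) (m ∸ i)) - inv (suc i) * (ℕ→ℚ k * L (suc j) k)
        ≡⟨ alg′ (inv (suc i)) (ℕ→ℚ (m ∸ i) * L (suc j) (m ∸ i)) (ℕ→ℚ k * L (suc j) k) ⟩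
      inv (suc i) * (ℕ→ℚ (m ∸ i) * L (suc j) (m ∸ i) - ℕ→ℚ k * L (suc j) k)
        ≡⟨ cong (λ l → inv (suc i) * (ℕ→ℚ l * L (suc j) l - ℕ→ℚ k * L (suc j) k)) (ℕₚ.+-∸-assoc 1 i<m) ⟩
      inv (suc i) * (ℕ→ℚ (suc k) * L (suc j) (suc k) - ℕ→ℚ k * L (suc j) k)
        ≡⟨ cong (inv (suc i) *_) (L-derivative j k) ⟩
      inv (suc i) * (ℕ→ℚ (suc j) * L j k)
        ≡⟨ alg″ (inv (suc i)) (ℕ→ℚ (suc j)) (L j k) ⟩
      ℕ→ℚ (suc j) * (inv (suc i) * L j k) ∎
      where k = m ∸ suc i

-- p-integral rationals and congruence modulo p.

module ModPrime (p : ℕ) (p-prime : Prime p) where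

  -- Any denominator prime to p is accepted, not only the reduced one, so closure under sums and
  -- products needs no cancellation of fractions, only that p is prime.
  record Integral (x : ℚ) : Set where
    constructor integral
    field
      denom      : ℕ
      p∤denom    : ¬ (p ∣ denom)
      numer      : ℤ
      denom*x    : ℕ→ℚ denom * x ≡ ℤ→ℚ numer

  1<p : 1 ℕ.< p
  1<p = ℕ.nonTrivial⇒n>1 p ⦃ Prim.prime⇒nonTrivial p-prime ⦄

  0<p : 0 ℕ.< p
  0<p = ℕₚ.<-trans z<s 1<p

  p∤1 : ¬ (p ∣ 1)
  p∤1 p∣1 = ℕₚ.<⇒≢ 1<p (sym (Div.∣1⇒≡1 p∣1))

  p∤m*n : ∀ {m n} → ¬ (p ∣ m) → ¬ (p ∣ n) → ¬ (p ∣ m ℕ.* n)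
  p∤m*n {m} {n} p∤m p∤n p∣mn with euclidsLemma m n p-prime p∣mn
  ... | inj₁ p∣m = p∤m p∣m
  ... | inj₂ p∣n = p∤n p∣n

  0<k<p⇒p∤k : ∀ {k} → k ℕ.< p → 0 ℕ.< k → ¬ (p ∣ k)
  0<k<p⇒p∤k {suc k} k<p _ p∣k = ℕₚ.<⇒≱ k<p (Div.∣⇒≤ p∣k)

  ℤ-integral : ∀ z → Integral (ℤ→ℚ z)
  ℤ-integral z = integral 1 p∤1 z (ℚₚ.*-identityˡ (ℤ→ℚ z))

  ℕ-integral : ∀ n → Integral (ℕ→ℚ n)
  ℕ-integral n = ℤ-integral (+ n)

  +-integral : ∀ {x y} → Integral x → Integral y → Integral (x + y)
  +-integral {x} {y} (integral d p∤d a d*x) (integral f p∤f b f*y) =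
    integral (d ℕ.* f) (p∤m*n p∤d p∤f) (+ f ℤ.* a ℤ.+ + d ℤ.* b) (begin
      ℕ→ℚ (d ℕ.* f) * (x + y)
        ≡⟨ cong (_* (x + y)) (ℕ→ℚ-* d f) ⟩
      ℕ→ℚ d * ℕ→ℚ f * (x + y)
        ≡⟨ lem (ℕ→ℚ d) (ℕ→ℚ f) x y ⟩
      ℕ→ℚ f * (ℕ→ℚ d * x) + ℕ→ℚ d * (ℕ→ℚ f * y)
        ≡⟨ cong₂ (λ u v → ℕ→ℚ f * u + ℕ→ℚ d * v) d*x f*y ⟩
      ℕ→ℚ f * ℤ→ℚ a + ℕ→ℚ d * ℤ→ℚ b
        ≡⟨ cong₂ _+_ (ℤ→ℚ-* (+ f) a) (ℤ→ℚ-* (+ d) b) ⟨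
      ℤ→ℚ (+ f ℤ.* a) + ℤ→ℚ (+ d ℤ.* b)
        ≡⟨ ℤ→ℚ-+ (+ f ℤ.* a) (+ d ℤ.* b) ⟨
      ℤ→ℚ (+ f ℤ.* a ℤ.+ + d ℤ.* b) ∎)
    where
    open ≡-Reasoning
    lem : ∀ d f x y → d * f * (x + y) ≡ f * (d * x) + d * (f * y)
    lem = solve-∀ ℚ-ring

  *-integral : ∀ {x y} → Integral x → Integral y → Integral (x * y)
  *-integral {x} {y} (integral d p∤d a d*x) (integral f p∤f b f*y) =
    integral (d ℕ.* f) (p∤m*n p∤d p∤f) (a ℤ.* b) (begin
      ℕ→ℚ (d ℕ.* f) * (x * y)
        ≡⟨ cong (_* (x * y)) (ℕ→ℚ-* d f) ⟩
      ℕ→ℚ d * ℕ→ℚ f * (x * y)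
        ≡⟨ lem (ℕ→ℚ d) (ℕ→ℚ f) x y ⟩
      (ℕ→ℚ d * x) * (ℕ→ℚ f * y)
        ≡⟨ cong₂ _*_ d*x f*y ⟩
      ℤ→ℚ a * ℤ→ℚ b
        ≡⟨ ℤ→ℚ-* a b ⟨
      ℤ→ℚ (a ℤ.* b) ∎)
    where
    open ≡-Reasoning
    lem : ∀ d f x y → d * f * (x * y) ≡ (d * x) * (f * y)
    lem = solve-∀ ℚ-ring

  neg-integral : ∀ {x} → Integral x → Integral (- x)
  neg-integral {x} i = subst Integral (lem x) (*-integral (ℤ-integral (ℤ.- + 1)) i)
    where
    lem : ∀ x → (- 1ℚ) * x ≡ - x
    lem = solve-∀ ℚ-ring

  minus-integral : ∀ {x y} → Integral x → Integral y → Integral (x - y)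
  minus-integral i j = +-integral i (neg-integral j)

  inv-integral : ∀ k → ¬ (p ∣ k) → Integral (inv k)
  inv-integral zero    _   = ℕ-integral 0
  inv-integral (suc k) p∤k = integral (suc k) p∤k (+ 1) (trans (ℚₚ.*-comm (ℕ→ℚ (suc k)) (inv (suc k))) (inv-inverseˡ k))

  ∑-integral : ∀ n {f} → (∀ i → i ℕ.< n → Integral (f i)) → Integral (∑ n f)
  ∑-integral zero    _ = ℕ-integral 0
  ∑-integral (suc n) h = +-integral (h 0 z<s) (∑-integral n (λ i i<n → h (suc i) (s<s i<n)))

  pow-integral : ∀ {x} n → Integral x → Integral (pow x n)
  pow-integral zero    _ = ℕ-integral 1
  pow-integral (suc n) i = *-integral i (pow-integral n i)

  -- If c = n / den is reduced and d c = z, then d n = z den. Were p a divisor of den, it would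
  -- divide d n and hence n, against coprimality.
  Integral⇒p∤denominator : ∀ {c} → Integral c → ¬ (p ∣ ℚ.denominatorℕ c)
  Integral⇒p∤denominator {c@(mkℚ n d-1 coprime)} (integral d p∤d z d*c) p∣den = p∤m*n p∤d p∤n p∣d*n
    where
    eq : + d ℤ.* n ≡ z ℤ.* + suc d-1
    eq with ℚᵘₚ.≃-trans (ℚᵘₚ.≃-sym (ℚᵘₚ.≃-trans (ℚₚ.toℚᵘ-homo-* (ℕ→ℚ d) c) (ℚᵘₚ.*-cong (toℚᵘ-ℤ→ℚ (+ d)) (ℚᵘₚ.≃-refl {toℚᵘ c}))))
           (ℚᵘₚ.≃-trans (ℚᵘₚ.≃-reflexive (cong toℚᵘ d*c)) (toℚᵘ-ℤ→ℚ z))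
    ... | *≡* h = trans (sym (ℤₚ.*-identityʳ (+ d ℤ.* n))) (trans h (cong (λ m → z ℤ.* + m) (ℕₚ.+-identityʳ (suc d-1))))
    p∣d*n : p ∣ d ℕ.* ℤ.∣ n ∣
    p∣d*n = subst (p ∣_) (trans (sym (ℤₚ.abs-* z (+ suc d-1))) (trans (cong ℤ.∣_∣ (sym eq)) (ℤₚ.abs-* (+ d) n)))
      (Div.∣n⇒∣m*n ℤ.∣ z ∣ p∣den)
    p∤n : ¬ (p ∣ ℤ.∣ n ∣)
    p∤n p∣n = p∤1 (subst (p ∣_) (Coprime.recompute coprime (p∣n , p∣den)) Div.∣-refl)

  infix 4 _≋_
  record _≋_ (x y : ℚ) : Set where
    constructor congruent
    field
      quotient  : ℚ
      integrality : Integral quotient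
      equality  : x - y ≡ ℕ→ℚ p * quotient

  ≋⇒≡[mod] : ∀ {x y} → x ≋ y → x ≡ y [modℚ p ]
  ≋⇒≡[mod] (congruent c i eq) = c , eq , Integral⇒p∤denominator i

  ≋-reflexive : ∀ {x y} → x ≡ y → x ≋ y
  ≋-reflexive {x} refl = congruent 0ℚ (ℕ-integral 0) (lem x (ℕ→ℚ p))
    where
    lem : ∀ x y → x - x ≡ y * 0ℚ
    lem = solve-∀ ℚ-ring

  ≋-refl : ∀ {x} → x ≋ x
  ≋-refl = ≋-reflexive refl

  ≋-sym : ∀ {x y} → x ≋ y → y ≋ x
  ≋-sym {x} {y} (congruent c i eq) = congruent (- c) (neg-integral i)
    (trans (lem x y) (trans (cong -_ eq) (lem′ (ℕ→ℚ p) c)))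
    where
    lem : ∀ x y → y - x ≡ - (x - y)
    lem = solve-∀ ℚ-ring
    lem′ : ∀ x y → - (x * y) ≡ x * - y
    lem′ = solve-∀ ℚ-ring

  +-cong-≋ : ∀ {x x′ y y′} → x ≋ x′ → y ≋ y′ → x + y ≋ x′ + y′
  +-cong-≋ {x} {x′} {y} {y′} (congruent c i eq) (congruent d j eq′) = congruent (c + d) (+-integral i j)
    (trans (lem x x′ y y′) (trans (cong₂ _+_ eq eq′) (sym (ℚₚ.*-distribˡ-+ (ℕ→ℚ p) c d))))
    where
    lem : ∀ x x′ y y′ → (x + y) - (x′ + y′) ≡ (x - x′) + (y - y′)
    lem = solve-∀ ℚ-ring

  ≋-trans : ∀ {x y z} → x ≋ y → y ≋ z → x ≋ z
  ≋-trans {x} {y} {z} (congruent c i eq) (congruent d j eq′) = congruent (c + d) (+-integral i j)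
    (trans (lem x y z) (trans (cong₂ _+_ eq eq′) (sym (ℚₚ.*-distribˡ-+ (ℕ→ℚ p) c d))))
    where
    lem : ∀ x y z → x - z ≡ (x - y) + (y - z)
    lem = solve-∀ ℚ-ring

  *-congˡ-≋ : ∀ {c x y} → Integral c → x ≋ y → c * x ≋ c * y
  *-congˡ-≋ {c} {x} {y} i (congruent d j eq) = congruent (c * d) (*-integral i j)
    (trans (lem c x y) (trans (cong (c *_) eq) (lem′ c (ℕ→ℚ p) d)))
    where
    lem : ∀ c x y → c * x - c * y ≡ c * (x - y)
    lem = solve-∀ ℚ-ring
    lem′ : ∀ c x y → c * (x * y) ≡ x * (c * y)
    lem′ = solve-∀ ℚ-ring

  *-congʳ-≋ : ∀ {c x y} → Integral c → x ≋ y → x * c ≋ y * c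
  *-congʳ-≋ {c} {x} {y} i h = subst₂ _≋_ (ℚₚ.*-comm c x) (ℚₚ.*-comm c y) (*-congˡ-≋ i h)

  neg-cong-≋ : ∀ {x y} → x ≋ y → - x ≋ - y
  neg-cong-≋ {x} {y} h = subst₂ _≋_ (lem x) (lem y) (*-congˡ-≋ (ℤ-integral (ℤ.- + 1)) h)
    where
    lem : ∀ x → (- 1ℚ) * x ≡ - x
    lem = solve-∀ ℚ-ring

  minus-cong-≋ : ∀ {x x′ y y′} → x ≋ x′ → y ≋ y′ → x - y ≋ x′ - y′
  minus-cong-≋ h h′ = +-cong-≋ h (neg-cong-≋ h′)

  ∑-cong-≋ : ∀ n {f g} → (∀ i → i ℕ.< n → f i ≋ g i) → ∑ n f ≋ ∑ n g
  ∑-cong-≋ zero    _ = ≋-refl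
  ∑-cong-≋ (suc n) h = +-cong-≋ (h 0 z<s) (∑-cong-≋ n (λ i i<n → h (suc i) (s<s i<n)))

  p*x≋0 : ∀ {x} → Integral x → ℕ→ℚ p * x ≋ 0ℚ
  p*x≋0 {x} i = congruent x i (lem (ℕ→ℚ p * x))
    where
    lem : ∀ x → x - 0ℚ ≡ x
    lem = solve-∀ ℚ-ring

  ℕ→ℚ-cancel-≋ : ∀ k → ¬ (p ∣ k) → ∀ {x y} → ℕ→ℚ k * x ≋ ℕ→ℚ k * y → x ≋ y
  ℕ→ℚ-cancel-≋ zero    p∤k _ = contradiction (p Div.∣0) p∤k
  ℕ→ℚ-cancel-≋ (suc k) p∤k {x} {y} h = subst₂ _≋_ (unit x) (unit y) (*-congˡ-≋ (inv-integral (suc k) p∤k) h)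
    where
    unit : ∀ z → inv (suc k) * (ℕ→ℚ (suc k) * z) ≡ z
    unit z = trans (sym (ℚₚ.*-assoc (inv (suc k)) (ℕ→ℚ (suc k)) z))
      (trans (cong (_* z) (inv-inverseˡ k)) (ℚₚ.*-identityˡ z))

  ≋-setoid : Setoid 0ℓ 0ℓ
  ≋-setoid = record { Carrier = ℚ ; _≈_ = _≋_ ; isEquivalence = record { refl = ≋-refl ; sym = ≋-sym ; trans = ≋-trans } }

  k<p⇒p∤k! : ∀ k → k ℕ.< p → ¬ (p ∣ k !)
  k<p⇒p∤k! zero    _   = p∤1
  k<p⇒p∤k! (suc k) k<p = p∤m*n (0<k<p⇒p∤k k<p z<s) (k<p⇒p∤k! k (ℕₚ.<-trans (ℕₚ.n<1+n k) k<p))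

  p∣pCk : ∀ k → 0 ℕ.< k → k ℕ.< p → p ∣ (p C k)
  p∣pCk k 0<k k<p = [ id , (λ h → contradiction h p∤k![p∸k]!) ]′
    (euclidsLemma (p C k) (k ! ℕ.* (p ∸ k) !) p-prime (subst (p ∣_) (sym factorisation) (n∣n! p (ℕₚ.<-trans 0<k k<p))))
    where
    p∤k![p∸k]! : ¬ (p ∣ k ! ℕ.* (p ∸ k) !)
    p∤k![p∸k]! = p∤m*n (k<p⇒p∤k! k k<p) (k<p⇒p∤k! (p ∸ k) (ℕₚ.∸-monoʳ-< 0<k (ℕₚ.<⇒≤ k<p)))
    factorisation : (p C k) ℕ.* (k ! ℕ.* (p ∸ k) !) ≡ p !
    factorisation = trans (cong (ℕ._* (k ! ℕ.* (p ∸ k) !)) (Comb.nCk≡n!/k![n-k]! (ℕₚ.<⇒≤ k<p)))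
      (DivMod.m/n*n≡m ⦃ ℕₚ._!*_!≢0 k (p ∸ k) ⦄ (Comb.k![n∸k]!∣n! (ℕₚ.<⇒≤ k<p)))
    n∣n! : ∀ n → 0 ℕ.< n → n ∣ n !
    n∣n! (suc n) _ = Div.m∣m*n (n !)

  fermat : ∀ i → pow (ℕ→ℚ i) p ≋ ℕ→ℚ i
  fermat zero    = ≋-reflexive (pow-0 0<p)
  fermat (suc i) = ≋-trans (≋-reflexive (trans (cong (λ x → pow x p) (ℕ→ℚ-suc i))
      (trans (pow-+ 1ℚ (ℕ→ℚ i) p) (⊛-binomial e (pow (ℕ→ℚ i)) p))))
    (≋-trans (binomial p refl) (≋-reflexive (sym (ℕ→ℚ-suc i))))
    where
    t : ℕ → ℚ
    t r = ℕ→ℚ (p C r) * e r * pow (ℕ→ℚ i) (p ∸ r)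
    -- The equation exposes the module parameter `p` as a successor, so that the first and last
    -- binomial terms can be split off.
    binomial : ∀ q → q ≡ p → ∑ (suc q) t ≋ 1ℚ + ℕ→ℚ i
    binomial zero    refl = contradiction 0<p λ ()
    binomial (suc q) refl = ≋-trans (+-cong-≋ first (≋-trans (≋-reflexive (∑-last q (t ∘ suc))) (+-cong-≋ middle (≋-reflexive last))))
      (≋-reflexive (lem (ℕ→ℚ i)))
      where
      lem : ∀ x → x + (0ℚ + 1ℚ) ≡ 1ℚ + x
      lem = solve-∀ ℚ-ring
      lem′ : ∀ x → 1ℚ * 1ℚ * x ≡ x
      lem′ = solve-∀ ℚ-ring
      first : t 0 ≋ ℕ→ℚ i
      first = ≋-trans (≋-reflexive (lem′ (pow (ℕ→ℚ i) p))) (fermat i)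
      last : t p ≡ 1ℚ
      last = trans (cong₂ (λ m n → ℕ→ℚ m * e p * pow (ℕ→ℚ i) n) (Comb.nCn≡1 p) (ℕₚ.n∸n≡0 p))
        (cong (λ x → 1ℚ * x * 1ℚ) (e≡1 p))
      middle : ∑ q (t ∘ suc) ≋ 0ℚ
      middle = ≋-trans (∑-cong-≋ q (λ r r<q → divisible r (p∣pCk (suc r) z<s (s<s r<q)))) (≋-reflexive (∑-0 q (λ _ _ → refl)))
        where
        divisible : ∀ r → p ∣ (p C suc r) → t (suc r) ≋ 0ℚ
        divisible r (divides c pCr≡c*p) = ≋-trans (≋-reflexive (begin
          ℕ→ℚ (p C suc r) * e (suc r) * y   ≡⟨ cong (λ m → ℕ→ℚ m * e (suc r) * y) pCr≡c*p ⟩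
          ℕ→ℚ (c ℕ.* p) * e (suc r) * y     ≡⟨ cong₂ (λ x z → x * z * y) (ℕ→ℚ-* c p) (e≡1 (suc r)) ⟩
          ℕ→ℚ c * ℕ→ℚ p * 1ℚ * y            ≡⟨ alg (ℕ→ℚ c) (ℕ→ℚ p) y ⟩
          ℕ→ℚ p * (ℕ→ℚ c * y)               ∎))
          (p*x≋0 (*-integral (ℕ-integral c) (pow-integral (p ∸ suc r) (ℕ-integral i))))
          where
          open ≡-Reasoning
          y = pow (ℕ→ℚ i) (p ∸ suc r)
          alg : ∀ c p y → c * p * 1ℚ * y ≡ p * (c * y)
          alg = solve-∀ ℚ-ring

  fermat-unit : ∀ {q} i → suc q ≡ p → ¬ (p ∣ i) → pow (ℕ→ℚ i) q ≋ 1ℚ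
  fermat-unit {q} i refl p∤i = ℕ→ℚ-cancel-≋ i p∤i (≋-trans (fermat i) (≋-reflexive (sym (ℚₚ.*-identityʳ (ℕ→ℚ i)))))

-- Reduction of the left-hand side to Q_N, with p = q + 1.

module Congruences (q : ℕ) (p-prime : Prime (suc q)) where

  open ModPrime (suc q) p-prime

  Δ-cong-≋ : ∀ k i {g h} → (∀ j → j ℕ.≤ k ℕ.+ i → g j ≋ h j) → Δ k g i ≋ Δ k h i
  Δ-cong-≋ zero    i g≋h = g≋h i ℕₚ.≤-refl
  Δ-cong-≋ (suc k) i g≋h = minus-cong-≋
    (Δ-cong-≋ k i (λ j j≤ → g≋h j (ℕₚ.m≤n⇒m≤1+n j≤)))
    (Δ-cong-≋ k (suc i) (λ j j≤ → g≋h j (subst (j ℕ.≤_) (ℕₚ.+-suc k i) j≤)))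

  -- By Fermat, i^{p-1} is 0 at i = 0 and 1 for 0 < i < p, that is, 1 minus the indicator of 0. A
  -- difference of positive order kills the constant, and (1 - E)^{k+1} takes the indicator of 0 to
  -- 1 at 0.
  T-fermat : ∀ k → k ℕ.< q → T (suc k) q ≋ - 1ℚ
  T-fermat k k<q = ≋-trans (Δ-cong-≋ (suc k) 0 power) (≋-reflexive (proj₁ (Δ-indicator k 0)))
    where
    indicator : Seq
    indicator zero    = 0ℚ
    indicator (suc _) = 1ℚ
    Δ-indicator : ∀ k i → Δ (suc k) indicator 0 ≡ - 1ℚ × Δ (suc k) indicator (suc i) ≡ 0ℚ
    Δ-indicator zero    i = refl , refl
    Δ-indicator (suc k) i = cong₂ _-_ (proj₁ (Δ-indicator k 0)) (proj₂ (Δ-indicator k 0))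
                          , cong₂ _-_ (proj₂ (Δ-indicator k i)) (proj₂ (Δ-indicator k (suc i)))
    power : ∀ j → j ℕ.≤ suc k ℕ.+ 0 → pow (ℕ→ℚ j) q ≋ indicator j
    power zero    _  = ≋-reflexive (pow-0 (ℕₚ.≤-<-trans z≤n k<q))
    power (suc j) j≤ = fermat-unit (suc j) refl (0<k<p⇒p∤k
      (s≤s (ℕₚ.≤-trans j≤ (ℕₚ.≤-trans (ℕₚ.≤-reflexive (ℕₚ.+-identityʳ (suc k))) k<q))) z<s)

  Δ-integral : ∀ k i {g} → (∀ j → Integral (g j)) → Integral (Δ k g i)
  Δ-integral zero    i h = h i
  Δ-integral (suc k) i h = minus-integral (Δ-integral k i h) (Δ-integral k (suc i) h)

  T-integral : ∀ k n → Integral (T k n)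
  T-integral k n = Δ-integral k 0 (λ i → pow-integral n (ℕ-integral i))

  inv-suc-integral : ∀ {k} → k ℕ.< q → Integral (inv (suc k))
  inv-suc-integral k<q = inv-integral _ (0<k<p⇒p∤k (s<s k<q) z<s)

  L-integral : ∀ j s → s ℕ.≤ q → Integral (L j s)
  L-integral zero    zero    _   = ℕ-integral 1
  L-integral zero    (suc s) _   = ℕ-integral 0
  L-integral (suc j) s       s≤q = subst Integral (sym (L-suc j s)) (∑-integral s (λ i i<s →
    *-integral (inv-suc-integral (ℕₚ.<-≤-trans i<s s≤q)) (L-integral j (s ∸ suc i) (ℕₚ.≤-trans (ℕₚ.m∸n≤m s (suc i)) s≤q))))

  -- With at least two positive parts no part can equal p, so 1/p does not occur.
  L-integral-p : ∀ j → Integral (L (suc (suc j)) (suc q))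
  L-integral-p j = subst Integral
    (sym (trans (L-suc (suc j) (suc q)) (trans (∑-last q f) (trans (cong (_+_ (∑ q f)) last≡0) (ℚₚ.+-identityʳ (∑ q f))))))
    (∑-integral q (λ i i<q → *-integral (inv-suc-integral i<q) (L-integral (suc j) (q ∸ i) (ℕₚ.m∸n≤m q i))))
    where
    f : ℕ → ℚ
    f i = inv (suc i) * L (suc j) (q ∸ i)
    last≡0 : f q ≡ 0ℚ
    last≡0 = trans (cong (λ m → inv (suc q) * L (suc j) m) (ℕₚ.n∸n≡0 q)) (ℚₚ.*-zeroʳ (inv (suc q)))

  -- The congruence for the coefficient of y^{p-k} with the denominator cleared, `suc k` standing
  -- for k and n = j + 2. For j = 0 it compares 1/(p - k) ≡ -1/k with `T-fermat`.
  L-congruence : ∀ j k → j ℕ.< q → k ℕ.< q →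
    ℕ→ℚ (suc k) * L (suc j) (q ∸ k) ≋ ℕ→ℚ (suc j !) * T (suc k) (q ∸ j)
  L-congruence zero k _ k<q = begin
    ℕ→ℚ (suc k) * L 1 (q ∸ k)
      ≡⟨ cong (λ s → ℕ→ℚ (suc k) * L 1 s) (ℕₚ.+-∸-assoc 1 k<q) ⟩
    ℕ→ℚ (suc k) * L 1 (suc m)
      ≡⟨ cong₂ _*_ k+1≡p-m (L-1 m) ⟩
    (ℕ→ℚ (suc q) - ℕ→ℚ (suc m)) * inv (suc m)
      ≡⟨ lem (ℕ→ℚ (suc q)) (ℕ→ℚ (suc m)) (inv (suc m)) ⟩
    ℕ→ℚ (suc q) * inv (suc m) - inv (suc m) * ℕ→ℚ (suc m)
      ≈⟨ minus-cong-≋ (p*x≋0 (inv-suc-integral m<q)) (≋-reflexive (inv-inverseˡ m)) ⟩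
    0ℚ - 1ℚ
      ≈⟨ T-fermat k k<q ⟨
    T (suc k) q
      ≡⟨ ℚₚ.*-identityˡ (T (suc k) q) ⟨
    1ℚ * T (suc k) q ∎
    where
    open SetoidReasoning ≋-setoid
    m = q ∸ suc k
    m<q : m ℕ.< q
    m<q = ℕₚ.∸-monoʳ-< z<s k<q
    lem : ∀ p m i → (p - m) * i ≡ p * i - i * m
    lem = solve-∀ ℚ-ring
    k+1≡p-m : ℕ→ℚ (suc k) ≡ ℕ→ℚ (suc q) - ℕ→ℚ (suc m)
    k+1≡p-m = trans (cong ℕ→ℚ (sym (ℕₚ.m∸[m∸n]≡n (s≤s (ℕₚ.<⇒≤ k<q)))))
      (trans (cong (λ s → ℕ→ℚ (suc q ∸ s)) (ℕₚ.+-∸-assoc 1 k<q)) (ℕ→ℚ-∸ (s≤s (ℕₚ.<⇒≤ m<q))))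
  L-congruence (suc j) k sj<q k<q = V (suc k) k<q
    where
    open SetoidReasoning ≋-setoid
    N = q ∸ suc j
    L₂ : ℕ → ℚ
    L₂ = L (suc (suc j))
    c = ℕ→ℚ (suc j !)
    q∸j : q ∸ j ≡ suc N
    q∸j = ℕₚ.+-∸-assoc 1 (ℕₚ.<⇒≤ sj<q)
    T-0-N : ∀ N → 0 ℕ.< N → T 0 N ≡ 0ℚ
    T-0-N (suc N) _ = T-zero-suc N
    -- The congruence for ℓ^{j+1} divided by k + 1, which `T-recurrence` makes visible as a factor
    -- on the right.
    L₁ : ∀ k → k ℕ.< q → L (suc j) (q ∸ k) ≋ c * (T (suc k) N - T k N)
    L₁ k k<q = ℕ→ℚ-cancel-≋ (suc k) (0<k<p⇒p∤k (s<s k<q) z<s) (begin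
      ℕ→ℚ (suc k) * L (suc j) (q ∸ k)            ≈⟨ L-congruence j k (ℕₚ.<⇒≤ sj<q) k<q ⟩
      c * T (suc k) (q ∸ j)                      ≡⟨ cong (λ s → c * T (suc k) s) q∸j ⟩
      c * T (suc k) (suc N)                      ≡⟨ cong (c *_) (T-recurrence k N) ⟩
      c * (ℕ→ℚ (suc k) * (T (suc k) N - T k N))  ≡⟨ lem c (ℕ→ℚ (suc k)) (T (suc k) N - T k N) ⟩
      ℕ→ℚ (suc k) * (c * (T (suc k) N - T k N))  ∎)
      where
      lem : ∀ x y z → x * (y * z) ≡ y * (x * z)
      lem = solve-∀ ℚ-ring
    -- Induction from k = 0, where the factor k removes the coefficient of y^p and `T 0 N` vanishes
    -- as N > 0. In the step, the weights p - k and p - k - 1 of `L-derivative` reduce to -k and -(k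
    -- + 1).
    V : ∀ k → k ℕ.≤ q → ℕ→ℚ k * L₂ (suc q ∸ k) ≋ ℕ→ℚ (suc (suc j) !) * T k N
    V zero    _   = ≋-reflexive (trans (ℚₚ.*-zeroˡ (L₂ (suc q))) (sym (trans
      (cong (ℕ→ℚ (suc (suc j) !) *_) (T-0-N N (ℕₚ.m<n⇒0<n∸m sj<q))) (ℚₚ.*-zeroʳ (ℕ→ℚ (suc (suc j) !))))))
    V (suc k) k<q = begin
      K′ * y
        ≡⟨ alg₁ K′ m′ (M * x) y ⟩
      (K′ + m′) * y + (M * x - m′ * y) - M * x
        ≡⟨ cong₂ (λ u v → u * y + (M * x - m′ * y) - v * x) sum₁ sum₂ ⟩
      P * y + (M * x - m′ * y) - (P - K) * x
        ≡⟨ cong (λ u → P * y + u - (P - K) * x) (L-derivative (suc j) m) ⟩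
      P * y + J * L (suc j) m - (P - K) * x
        ≡⟨ alg₂ (P * y) (J * L (suc j) m) P K x ⟩
      P * y - P * x + (J * L (suc j) m + K * x)
        ≈⟨ +-cong-≋ (minus-cong-≋ (p*x≋0 (L-integral (suc (suc j)) m (ℕₚ.m∸n≤m q k))) (p*x≋0 x-integral))
             (+-cong-≋ (*-congˡ-≋ (ℕ-integral (suc (suc j))) (L₁ k k<q))
                (≋-trans (≋-reflexive (cong (λ s → K * L₂ s) (sym p∸k))) (V k (ℕₚ.<⇒≤ k<q)))) ⟩
      0ℚ - 0ℚ + (J * (c * (T (suc k) N - T k N)) + ℕ→ℚ (suc (suc j) !) * T k N)
        ≡⟨ cong (λ u → 0ℚ - 0ℚ + (J * (c * (T (suc k) N - T k N)) + u * T k N)) (ℕ→ℚ-* (suc (suc j)) (suc j !)) ⟩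
      0ℚ - 0ℚ + (J * (c * (T (suc k) N - T k N)) + J * c * T k N)
        ≡⟨ alg₃ J c (T (suc k) N) (T k N) ⟩
      J * c * T (suc k) N
        ≡⟨ cong (_* T (suc k) N) (ℕ→ℚ-* (suc (suc j)) (suc j !)) ⟨
      ℕ→ℚ (suc (suc j) !) * T (suc k) N ∎
      where
      m = q ∸ k
      p∸k : suc q ∸ k ≡ suc m
      p∸k = ℕₚ.+-∸-assoc 1 (ℕₚ.<⇒≤ k<q)
      x = L₂ (suc m)
      y = L₂ m
      K = ℕ→ℚ k
      K′ = ℕ→ℚ (suc k)
      M = ℕ→ℚ (suc m)
      m′ = ℕ→ℚ m
      P = ℕ→ℚ (suc q)
      J = ℕ→ℚ (suc (suc j))
      sum₁ : K′ + m′ ≡ P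
      sum₁ = trans (sym (ℕ→ℚ-+ (suc k) m)) (cong (ℕ→ℚ ∘ suc) (ℕₚ.m+[n∸m]≡n (ℕₚ.<⇒≤ k<q)))
      sum₂ : M ≡ P - K
      sum₂ = trans (cong ℕ→ℚ (sym p∸k)) (ℕ→ℚ-∸ (ℕₚ.m≤n⇒m≤1+n (ℕₚ.<⇒≤ k<q)))
      -- The index of `x` is p - k; for k = 0 it is p itself, beyond the range of `L-integral`.
      x-integral : Integral x
      x-integral = [ (λ m<q → L-integral (suc (suc j)) (suc m) m<q) , (λ m≡q → subst (Integral ∘ L₂ ∘ suc) (sym m≡q) (L-integral-p j)) ]′
        (ℕₚ.m≤n⇒m<n∨m≡n (ℕₚ.m∸n≤m q k))
      alg₁ : ∀ k n z y → k * y ≡ (k + n) * y + (z - n * y) - z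
      alg₁ = solve-∀ ℚ-ring
      alg₂ : ∀ a b p k x → a + b - (p - k) * x ≡ a - p * x + (b + k * x)
      alg₂ = solve-∀ ℚ-ring
      alg₃ : ∀ a c t u → 0ℚ - 0ℚ + (a * (c * (t - u)) + a * c * u) ≡ a * c * t
      alg₃ = solve-∀ ℚ-ring

  sign-integral : ∀ k → Integral (sign k)
  sign-integral zero    = ℕ-integral 1
  sign-integral (suc k) = neg-integral (sign-integral k)

  leg3-integral : ∀ k → Integral (leg3 k)
  leg3-integral 0 = ℕ-integral 0
  leg3-integral 1 = ℕ-integral 1
  leg3-integral 2 = ℤ-integral (ℤ.- + 1)
  leg3-integral (suc (suc (suc k))) = leg3-integral k

  coef-integral : ∀ k → Integral (coef k)
  coef-integral k = *-integral (sign-integral k) (minus-integral (leg3-integral (suc k)) (leg3-integral (k ∸ 1)))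

  dilogCoef-integral : ∀ k → k ℕ.< q → Integral (dilogCoef (suc k))
  dilogCoef-integral k k<q = *-integral (*-integral (coef-integral (suc k)) (inv-suc-integral k<q)) (inv-suc-integral k<q)

  Q-sum : ∀ n → n ℕ.≤ q → Q n ≡ ∑ q (λ i → dilogCoef (suc i) * T (suc i) n)
  Q-sum n n≤q = trans (τ-sum n≤q dilogCoef) (trans
    (cong (_+ ∑ q (λ i → dilogCoef (suc i) * T (suc i) n)) (ℚₚ.*-zeroˡ (T 0 n)))
    (ℚₚ.+-identityˡ (∑ q (λ i → dilogCoef (suc i) * T (suc i) n))))

  Q-integral : ∀ n → n ℕ.≤ q → Integral (Q n)
  Q-integral n n≤q = subst Integral (sym (Q-sum n n≤q))
    (∑-integral q (λ i i<q → *-integral (dilogCoef-integral i i<q) (T-integral (suc i) n)))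

  -- The first part contributes c_k / k and `L-congruence` another 1/k; this is how the
  -- dilogarithmic coefficients arise.
  LHS-congruence : ∀ j → j ℕ.< q → LHS (suc (suc j)) (suc q) ≋ ℕ→ℚ (suc j !) * Q (q ∸ j)
  LHS-congruence j j<q = begin
    LHS (suc (suc j)) (suc q)
      ≡⟨ LHS-suc (suc j) (suc q) ⟩
    ∑ (suc q) f
      ≡⟨ ∑-last q f ⟩
    -- First part p, the only summand with p in a denominator: the other parts would have to add up
    -- to 0, so its cofactor is 0.
    ∑ q f + logCoef (suc q) * L (suc j) (q ∸ q)
      ≡⟨ cong (λ m → ∑ q f + logCoef (suc q) * L (suc j) m) (ℕₚ.n∸n≡0 q) ⟩
    ∑ q f + logCoef (suc q) * 0ℚ
      ≡⟨ lem (∑ q f) (logCoef (suc q)) ⟩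
    ∑ q f
      ≈⟨ ∑-cong-≋ q term ⟩
    ∑ q (λ i → c * (dilogCoef (suc i) * T (suc i) (q ∸ j)))
      ≡⟨ ∑-*ˡ q c (λ i → dilogCoef (suc i) * T (suc i) (q ∸ j)) ⟩
    c * ∑ q (λ i → dilogCoef (suc i) * T (suc i) (q ∸ j))
      ≡⟨ cong (c *_) (Q-sum (q ∸ j) (ℕₚ.m∸n≤m q j)) ⟨
    c * Q (q ∸ j) ∎
    where
    open SetoidReasoning ≋-setoid
    c = ℕ→ℚ (suc j !)
    f : ℕ → ℚ
    f i = logCoef (suc i) * L (suc j) (q ∸ i)
    lem : ∀ x y → x + y * 0ℚ ≡ x
    lem = solve-∀ ℚ-ring
    lem′ : ∀ a c t i → a * (i * (c * t)) ≡ c * (a * i * t)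
    lem′ = solve-∀ ℚ-ring
    term : ∀ i → i ℕ.< q → f i ≋ c * (dilogCoef (suc i) * T (suc i) (q ∸ j))
    term i i<q = begin
      logCoef (suc i) * L (suc j) (q ∸ i)
        ≡⟨ cong (logCoef (suc i) *_) (trans (sym (ℚₚ.*-identityˡ (L (suc j) (q ∸ i))))
             (trans (cong (_* L (suc j) (q ∸ i)) (sym (inv-inverseˡ i))) (ℚₚ.*-assoc (inv (suc i)) (ℕ→ℚ (suc i)) (L (suc j) (q ∸ i))))) ⟩
      logCoef (suc i) * (inv (suc i) * (ℕ→ℚ (suc i) * L (suc j) (q ∸ i)))
        ≈⟨ *-congˡ-≋ (*-integral (coef-integral (suc i)) (inv-suc-integral i<q))
             (*-congˡ-≋ (inv-suc-integral i<q) (L-congruence j i j<q i<q)) ⟩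
      logCoef (suc i) * (inv (suc i) * (c * T (suc i) (q ∸ j)))
        ≡⟨ lem′ (logCoef (suc i)) c (T (suc i) (q ∸ j)) (inv (suc i)) ⟩
      c * (dilogCoef (suc i) * T (suc i) (q ∸ j)) ∎

  -- Below the index p - 1 the recursion divides only by numbers smaller than p.
  B-integral : ∀ k → k ℕ.< q → Integral (B k)
  B-integral k = below (suc k) k (ℕₚ.n<1+n k)
    where
    below : ∀ n k → k ℕ.< n → k ℕ.< q → Integral (B k)
    below (suc n) zero    _         _   = ℕ-integral 1
    below (suc n) (suc k) (s≤s k<n) k<q = subst Integral (sym (B-suc k)) (neg-integral
      (*-integral (inv-suc-integral k<q) (∑-integral (suc k) (λ i i≤k →
        *-integral (ℕ-integral (suc (suc k) C i)) (below n i (ℕₚ.<-≤-trans i≤k k<n) (ℕₚ.<-trans i≤k k<q))))))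

  -- The recursion for B_{p-1} divides by p exactly once, and the earlier Bernoulli numbers are
  -- p-integral.
  p*B-integral : Integral (ℕ→ℚ (suc q) * B q)
  p*B-integral = lem q refl
    where
    alg : ∀ p i s → p * - (i * s) ≡ - (i * p * s)
    alg = solve-∀ ℚ-ring
    lem : ∀ n → n ≡ q → Integral (ℕ→ℚ (suc n) * B n)
    lem zero    _    = ℕ-integral 1
    lem (suc n) refl = subst Integral (sym eq) (neg-integral (∑-integral (suc n) (λ i i≤n →
      *-integral (ℕ-integral (suc (suc n) C i)) (B-integral i i≤n))))
      where
      S = ∑ (suc n) (λ k → ℕ→ℚ (suc (suc n) C k) * B k)
      eq : ℕ→ℚ (suc (suc n)) * B (suc n) ≡ - S
      eq = trans (cong (ℕ→ℚ (suc (suc n)) *_) (B-suc n)) (trans (alg (ℕ→ℚ (suc (suc n))) (inv (suc (suc n))) S)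
        (cong -_ (trans (cong (_* S) (inv-inverseˡ (suc n))) (ℚₚ.*-identityˡ S))))

-- Signs, and reflection of exponents m ↦ p - 1 - m.

pow-minus1-even : ∀ n → n % 2 ≡ 0 → pow (- 1ℚ) n ≡ 1ℚ
pow-minus1-even 0             _ = refl
pow-minus1-even (suc (suc n)) h = cong (λ x → - 1ℚ * (- 1ℚ * x)) (pow-minus1-even n h)

pow-minus1-odd : ∀ n → n % 2 ≡ 1 → pow (- 1ℚ) n ≡ - 1ℚ
pow-minus1-odd 1             _ = refl
pow-minus1-odd (suc (suc n)) h = cong (λ x → - 1ℚ * (- 1ℚ * x)) (pow-minus1-odd n h)

odd-prime : ∀ {p} → Prime p → 2 ℕ.< p → p % 2 ≡ 1
odd-prime {p} p-prime 2<p with p % 2 in eq | DivMod.m%n<n p 2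
... | 0 | _ = contradiction (Prim.prime⇒irreducible p-prime (Div.m%n≡0⇒n∣m p 2 eq))
  λ { (inj₁ ()) ; (inj₂ 2≡p) → ℕₚ.<⇒≢ 2<p 2≡p }
... | 1 | _ = refl
... | suc (suc _) | s≤s (s≤s ())

ℕ→ℚ-power∸1 : ∀ a n → ℕ→ℚ (suc a ℕ.^ n ∸ 1) ≡ pow (ℕ→ℚ (suc a)) n - 1ℚ
ℕ→ℚ-power∸1 a n = trans (ℕ→ℚ-∸ (ℕₚ.m^n>0 (suc a) n)) (cong (_- 1ℚ) (pow-ℕ (suc a) n))

module Reduction (q : ℕ) (p-prime : Prime (suc q)) (3<p : 3 ℕ.< suc q) where

  open ModPrime (suc q) p-prime
  open Congruences q p-prime

  p∤2 : ¬ (suc q ∣ 2)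
  p∤2 = 0<k<p⇒p∤k (ℕₚ.<-trans (ℕₚ.n<1+n 2) 3<p) z<s

  p∤3 : ¬ (suc q ∣ 3)
  p∤3 = 0<k<p⇒p∤k 3<p z<s

  p∤6^ : ∀ n → ¬ (suc q ∣ 6 ℕ.^ n)
  p∤6^ zero    = p∤1
  p∤6^ (suc n) = p∤m*n (p∤m*n {2} {3} p∤2 p∤3) (p∤6^ n)

  inv-inverse : ∀ k → ¬ (suc q ∣ k) → inv k * ℕ→ℚ k ≡ 1ℚ
  inv-inverse zero    p∤0 = contradiction (suc q Div.∣0) p∤0
  inv-inverse (suc k) _   = inv-inverseˡ k

  pow-reflect : ∀ a {e n} → ¬ (suc q ∣ a) → e ℕ.+ n ≡ q →
    pow (ℕ→ℚ a) e * (pow (ℕ→ℚ a) n - 1ℚ) ≋ 1ℚ - pow (ℕ→ℚ a) e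
  pow-reflect a {e} {n} p∤a e+n≡q = begin
    x * (pow (ℕ→ℚ a) n - 1ℚ)   ≡⟨ lem x (pow (ℕ→ℚ a) n) ⟩
    x * pow (ℕ→ℚ a) n - x      ≡⟨ cong (_- x) (trans (sym (pow-split (ℕ→ℚ a) e n)) (cong (pow (ℕ→ℚ a)) e+n≡q)) ⟩
    pow (ℕ→ℚ a) q - x          ≈⟨ minus-cong-≋ (fermat-unit a refl p∤a) (≋-refl {x}) ⟩
    1ℚ - x                     ∎
    where
    open SetoidReasoning ≋-setoid
    x = pow (ℕ→ℚ a) e
    lem : ∀ x y → x * (y - 1ℚ) ≡ x * y - x
    lem = solve-∀ ℚ-ring

  γ-integral : ∀ n → Integral (γ n)
  γ-integral n = *-integral (minus-integral (pow-integral n (ℕ-integral 3)) (ℕ-integral 1))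
                            (minus-integral (pow-integral n (ℕ-integral 2)) (ℕ-integral 1))

  -- Since 6^e = 3^e 2^e, each factor of γ receives its own power; by Fermat a^e (a^n - 1) ≡ 1 -
  -- a^e, and the two changes of sign cancel.
  γ-reflect : ∀ e n → e ℕ.+ n ≡ q → pow (ℕ→ℚ 6) e * γ n ≋ γ e
  γ-reflect e n e+n≡q = begin
    pow (ℕ→ℚ 6) e * γ n
      ≡⟨ cong (_* γ n) (pow-distrib (ℕ→ℚ 3) (ℕ→ℚ 2) e) ⟩
    u * v * ((pow (ℕ→ℚ 3) n - 1ℚ) * y)
      ≡⟨ lem u v (pow (ℕ→ℚ 3) n - 1ℚ) y ⟩
    u * (pow (ℕ→ℚ 3) n - 1ℚ) * (v * y)
      ≈⟨ *-congʳ-≋ (*-integral (pow-integral e (ℕ-integral 2)) (minus-integral (pow-integral n (ℕ-integral 2)) (ℕ-integral 1)))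
           (pow-reflect 3 {e} {n} p∤3 e+n≡q) ⟩
    (1ℚ - u) * (v * y)
      ≈⟨ *-congˡ-≋ (minus-integral (ℕ-integral 1) (pow-integral e (ℕ-integral 3))) (pow-reflect 2 {e} {n} p∤2 e+n≡q) ⟩
    (1ℚ - u) * (1ℚ - v)
      ≡⟨ lem′ u v ⟩
    γ e ∎
    where
    open SetoidReasoning ≋-setoid
    u = pow (ℕ→ℚ 3) e
    v = pow (ℕ→ℚ 2) e
    y = pow (ℕ→ℚ 2) n - 1ℚ
    lem : ∀ u v x y → u * v * (x * y) ≡ u * x * (v * y)
    lem = solve-∀ ℚ-ring
    lem′ : ∀ u v → (1ℚ - u) * (1ℚ - v) ≡ (u - 1ℚ) * (v - 1ℚ)
    lem′ = solve-∀ ℚ-ring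

  -- As (e + 1) + (m + 1) = p, the reciprocals satisfy 1/(m + 1) ≡ -1/(e + 1), which absorbs the
  -- minus sign.
  γ/n-reflect : ∀ e m → e ℕ.+ suc m ≡ q → - (γ (suc m) * inv (suc m)) ≋ γ e * inv (suc e ℕ.* 6 ℕ.^ e)
  γ/n-reflect e m e+n≡q = ℕ→ℚ-cancel-≋ (suc m ℕ.* d) (p∤m*n p∤n p∤d) (begin
    ℕ→ℚ (suc m ℕ.* d) * - (γ (suc m) * inv (suc m))
      ≡⟨ cong (_* - (γ (suc m) * inv (suc m))) (trans (ℕ→ℚ-* (suc m) d) (cong (n *_) (trans (ℕ→ℚ-* (suc e) (6 ℕ.^ e)) (cong (e′ *_) (pow-ℕ 6 e))))) ⟩
    n * (e′ * s) * - (γ (suc m) * inv (suc m))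
      ≡⟨ lem₁ n e′ s (γ (suc m)) (inv (suc m)) ⟩
    inv (suc m) * n * (- e′ * (s * γ (suc m)))
      ≡⟨ trans (cong (_* (- e′ * (s * γ (suc m)))) (inv-inverseˡ m)) (ℚₚ.*-identityˡ (- e′ * (s * γ (suc m)))) ⟩
    - e′ * (s * γ (suc m))
      ≈⟨ *-congˡ-≋ (neg-integral (ℕ-integral (suc e))) (γ-reflect e (suc m) e+n≡q) ⟩
    - e′ * γ e
      ≡⟨ lem₂ e′ n (γ e) ⟩
    n * γ e - (e′ + n) * γ e
      ≡⟨ cong (λ x → n * γ e - x * γ e) (trans (sym (ℕ→ℚ-+ (suc e) (suc m))) (cong (ℕ→ℚ ∘ suc) e+n≡q)) ⟩
    n * γ e - ℕ→ℚ (suc q) * γ e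
      ≈⟨ minus-cong-≋ (≋-refl {n * γ e}) (p*x≋0 (γ-integral e)) ⟩
    n * γ e - 0ℚ
      ≡⟨ trans (lem₃ (n * γ e)) (cong (_* (n * γ e)) (sym (inv-inverse d p∤d))) ⟩
    inv d * ℕ→ℚ d * (n * γ e)
      ≡⟨ lem₄ (inv d) (ℕ→ℚ d) n (γ e) ⟩
    n * ℕ→ℚ d * (γ e * inv d)
      ≡⟨ cong (_* (γ e * inv d)) (ℕ→ℚ-* (suc m) d) ⟨
    ℕ→ℚ (suc m ℕ.* d) * (γ e * inv d) ∎)
    where
    open SetoidReasoning ≋-setoid
    d = suc e ℕ.* 6 ℕ.^ e
    n = ℕ→ℚ (suc m)
    e′ = ℕ→ℚ (suc e)
    s = pow (ℕ→ℚ 6) e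
    n≤q : suc m ℕ.≤ q
    n≤q = subst (suc m ℕ.≤_) e+n≡q (ℕₚ.m≤n+m (suc m) e)
    e<q : e ℕ.< q
    e<q = subst (e ℕ.<_) e+n≡q (ℕₚ.m<m+n e z<s)
    p∤n : ¬ (suc q ∣ suc m)
    p∤n = 0<k<p⇒p∤k (s≤s n≤q) z<s
    p∤d : ¬ (suc q ∣ d)
    p∤d = p∤m*n (0<k<p⇒p∤k (s<s e<q) z<s) (p∤6^ e)
    lem₁ : ∀ n e s g i → n * (e * s) * - (g * i) ≡ i * n * (- e * (s * g))
    lem₁ = solve-∀ ℚ-ring
    lem₂ : ∀ e n g → - e * g ≡ n * g - (e + n) * g
    lem₂ = solve-∀ ℚ-ring
    lem₃ : ∀ x → x - 0ℚ ≡ 1ℚ * x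
    lem₃ = solve-∀ ℚ-ring
    lem₄ : ∀ i d n g → i * d * (n * g) ≡ n * d * (g * i)
    lem₄ = solve-∀ ℚ-ring

  -- For e = 0 the Bernoulli number B_{p−1} is not p-integral, but p divides both factors of γ (p − 1).
  γB/n-reflect : ∀ e m → e ℕ.+ suc m ≡ q →
    - (γ (suc m) * inv (suc m)) * B (suc m) ≋ γ e * inv (suc e ℕ.* 6 ℕ.^ e) * B (suc m)
  γB/n-reflect zero m refl = ≋-trans (go (pow≋1 3 p∤3) (pow≋1 2 p∤2)) (≋-reflexive (sym (lem (inv 1) (B (suc m)))))
    where
    pow≋1 : ∀ a → ¬ (suc q ∣ a) → pow (ℕ→ℚ a) q ≋ 1ℚ
    pow≋1 a p∤a = fermat-unit a refl p∤a
    lem : ∀ i b → 0ℚ * i * b ≡ 0ℚ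
    lem = solve-∀ ℚ-ring
    lem′ : ∀ p c d i b → - (p * c * (p * d) * i) * b ≡ p * (- (c * d * i) * (p * b))
    lem′ = solve-∀ ℚ-ring
    go : pow (ℕ→ℚ 3) q ≋ 1ℚ → pow (ℕ→ℚ 2) q ≋ 1ℚ → - (γ q * inv q) * B q ≋ 0ℚ
    go (congruent c c-int h₃) (congruent d d-int h₂) = ≋-trans
      (≋-reflexive (trans (cong₂ (λ x y → - (x * y * inv q) * B q) h₃ h₂) (lem′ (ℕ→ℚ (suc q)) c d (inv q) (B q))))
      (p*x≋0 (*-integral (neg-integral (*-integral (*-integral c-int d-int)
        (inv-integral q (0<k<p⇒p∤k (ℕₚ.n<1+n q) z<s)))) p*B-integral))
  γB/n-reflect (suc e) m e+n≡q = *-congʳ-≋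
    (B-integral (suc m) (subst (suc m ℕ.<_) e+n≡q (s≤s (ℕₚ.m≤n+m (suc m) e)))) (γ/n-reflect (suc e) m e+n≡q)

  -- The two parities of n = j + 2.

  module Cases (j : ℕ) (n<q : suc (suc j) ℕ.< q) where

    -- This is p - n, so that N = M + 1.
    M : ℕ
    M = q ∸ suc j

    sj<q : suc j ℕ.< q
    sj<q = ℕₚ.<-trans (ℕₚ.n<1+n (suc j)) n<q

    q∸j≡ : q ∸ j ≡ suc M
    q∸j≡ = ℕₚ.+-∸-assoc 1 (ℕₚ.<⇒≤ sj<q)

    sj+M≡q : suc j ℕ.+ M ≡ q
    sj+M≡q = ℕₚ.m+[n∸m]≡n (ℕₚ.<⇒≤ sj<q)

    M<q : M ℕ.< q
    M<q = ℕₚ.∸-monoʳ-< z<s (ℕₚ.<⇒≤ sj<q)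

    pow-p : pow (- 1ℚ) (suc (suc j)) * pow (- 1ℚ) M ≡ - 1ℚ
    pow-p = trans (sym (pow-split (- 1ℚ) (suc (suc j)) M))
      (trans (cong (pow (- 1ℚ) ∘ suc) sj+M≡q)
        (pow-minus1-odd (suc q) (odd-prime p-prime (ℕₚ.<-trans (ℕₚ.n<1+n 2) 3<p))))

    LHS≋ : LHS (suc (suc j)) (suc q) ≋ ℕ→ℚ (suc j !) * Q (suc M)
    LHS≋ = ≋-trans (LHS-congruence j (ℕₚ.<-trans (ℕₚ.n<1+n j) sj<q)) (≋-reflexive (cong (λ m → ℕ→ℚ (suc j !) * Q m) q∸j≡))

    -- Since (n - 1) + N = p, (n - 1)! Q_N ≡ -(n - 2)! N Q_N, and the formula for N Q_N applies. As
    -- p is odd, N is even and the signs (-1)^r (-1)^{N-r} cancel; the exponent N - r reflects to n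
    -- + r - 2.
    even-case : suc (suc j) % 2 ≡ 0 → LHS (suc (suc j)) (suc q) ≋ RHSeven (suc (suc j)) (suc q)
    even-case n-even = begin
      LHS (suc (suc j)) (suc q)
        ≈⟨ LHS≋ ⟩
      ℕ→ℚ (suc j !) * Q (suc M)
        ≡⟨ cong (_* Q (suc M)) (ℕ→ℚ-* (suc j) (j !)) ⟩
      J * c * Q (suc M)
        ≡⟨ lem J N c (Q (suc M)) ⟩
      (J + N) * (c * Q (suc M)) - c * (N * Q (suc M))
        ≡⟨ cong₂ (λ x y → x * (c * Q (suc M)) - c * y) J+N≡p (Q-binomial M) ⟩
      ℕ→ℚ (suc q) * (c * Q (suc M)) - c * ∑ (suc M) t
        ≈⟨ minus-cong-≋ (p*x≋0 (*-integral (ℕ-integral (j !)) (Q-integral (suc M) M<q)))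
             (*-congˡ-≋ (ℕ-integral (j !)) (∑-cong-≋ (suc M) term-congruence)) ⟩
      0ℚ - c * ∑ (suc M) term
        ≡⟨ ℚₚ.+-identityˡ (- (c * ∑ (suc M) term)) ⟩
      - (c * ∑ (suc M) term)
        ≡⟨ cong (λ x → - (c * x)) (sumℚ-map-applyUpTo (suc M) term id) ⟨
      RHSeven (suc (suc j)) (suc q) ∎
      where
      open SetoidReasoning ≋-setoid
      J = ℕ→ℚ (suc j)
      N = ℕ→ℚ (suc M)
      c = ℕ→ℚ (j !)
      t term : ℕ → ℚ
      t r = ℕ→ℚ (suc M C r) * B⁺ r * F (suc M ∸ r)
      term r = ℕ→ℚ (suc M C r) * ℕ→ℚ (3 ℕ.^ (j ℕ.+ r) ∸ 1) * ℕ→ℚ (2 ℕ.^ (j ℕ.+ r) ∸ 1)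
        * B r * B (M ∸ r ℕ.+ 1) * inv (suc (j ℕ.+ r) ℕ.* 6 ℕ.^ (j ℕ.+ r))
      lem : ∀ j n c x → j * c * x ≡ (j + n) * (c * x) - c * (n * x)
      lem = solve-∀ ℚ-ring
      J+N≡p : J + N ≡ ℕ→ℚ (suc q)
      J+N≡p = trans (sym (ℕ→ℚ-+ (suc j) (suc M))) (cong ℕ→ℚ (trans (ℕₚ.+-suc (suc j) M) (cong suc sj+M≡q)))
      pow-N : pow (- 1ℚ) (suc M) ≡ - 1ℚ * - 1ℚ
      pow-N = cong (- 1ℚ *_) (trans (sym (ℚₚ.*-identityˡ (pow (- 1ℚ) M)))
        (trans (cong (_* pow (- 1ℚ) M) (sym (pow-minus1-even (suc (suc j)) n-even))) pow-p))
      alg₁ : ∀ a x b y b′ g i → a * (x * b) * - (g * (y * b′) * i) ≡ a * b * (x * y) * (- (g * i) * b′)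
      alg₁ = solve-∀ ℚ-ring
      alg₂ : ∀ a b u v i b′ → a * b * 1ℚ * (u * v * i * b′) ≡ a * u * v * b * b′ * i
      alg₂ = solve-∀ ℚ-ring
      term-congruence : ∀ r → r ℕ.< suc M → t r ≋ term r
      term-congruence r (s≤s r≤M) = begin
        a * B⁺ r * F (suc M ∸ r)
          ≡⟨ cong (λ s → a * B⁺ r * F s) (ℕₚ.+-∸-assoc 1 r≤M) ⟩
        a * B⁺ r * F (suc m)
          ≡⟨ cong (a * B⁺ r *_) (F-closed m) ⟩
        a * B⁺ r * - (γ (suc m) * B⁺ (suc m) * inv (suc m))
          ≡⟨ cong₂ (λ x y → a * x * - (γ (suc m) * y * inv (suc m))) (B⁺-parity r) (B⁺-parity (suc m)) ⟩
        a * (pow (- 1ℚ) r * B r) * - (γ (suc m) * (pow (- 1ℚ) (suc m) * B (suc m)) * inv (suc m))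
          ≡⟨ alg₁ a (pow (- 1ℚ) r) (B r) (pow (- 1ℚ) (suc m)) (B (suc m)) (γ (suc m)) (inv (suc m)) ⟩
        a * B r * (pow (- 1ℚ) r * pow (- 1ℚ) (suc m)) * (- (γ (suc m) * inv (suc m)) * B (suc m))
          ≡⟨ cong (λ x → a * B r * x * (- (γ (suc m) * inv (suc m)) * B (suc m)))
               (trans (sym (pow-split (- 1ℚ) r (suc m))) (trans (cong (pow (- 1ℚ)) r+sm) pow-N)) ⟩
        a * B r * 1ℚ * (- (γ (suc m) * inv (suc m)) * B (suc m))
          ≈⟨ *-congˡ-≋ (*-integral (*-integral (ℕ-integral (suc M C r)) (B-integral r (ℕₚ.≤-<-trans r≤M M<q))) (ℕ-integral 1))
               (γB/n-reflect (j ℕ.+ r) m e+n≡q) ⟩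
        a * B r * 1ℚ * (γ (j ℕ.+ r) * i * B (suc m))
          ≡⟨ alg₂ a (B r) (pow (ℕ→ℚ 3) (j ℕ.+ r) - 1ℚ) (pow (ℕ→ℚ 2) (j ℕ.+ r) - 1ℚ) i (B (suc m)) ⟩
        a * (pow (ℕ→ℚ 3) (j ℕ.+ r) - 1ℚ) * (pow (ℕ→ℚ 2) (j ℕ.+ r) - 1ℚ) * B r * B (suc m) * i
          ≡⟨ cong₂ (λ x y → a * x * y * B r * B (suc m) * i) (ℕ→ℚ-power∸1 2 (j ℕ.+ r)) (ℕ→ℚ-power∸1 1 (j ℕ.+ r)) ⟨
        a * ℕ→ℚ (3 ℕ.^ (j ℕ.+ r) ∸ 1) * ℕ→ℚ (2 ℕ.^ (j ℕ.+ r) ∸ 1) * B r * B (suc m) * i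
          ≡⟨ cong (λ s → a * ℕ→ℚ (3 ℕ.^ (j ℕ.+ r) ∸ 1) * ℕ→ℚ (2 ℕ.^ (j ℕ.+ r) ∸ 1) * B r * B s * i) (sym (ℕₚ.+-comm m 1)) ⟩
        term r ∎
        where
        m = M ∸ r
        a = ℕ→ℚ (suc M C r)
        i = inv (suc (j ℕ.+ r) ℕ.* 6 ℕ.^ (j ℕ.+ r))
        r+sm : r ℕ.+ suc m ≡ suc M
        r+sm = trans (ℕₚ.+-suc r m) (cong suc (ℕₚ.m+[n∸m]≡n r≤M))
        e+n≡q : j ℕ.+ r ℕ.+ suc m ≡ q
        e+n≡q = trans (ℕₚ.+-assoc j r (suc m)) (trans (cong (j ℕ.+_) r+sm) (trans (ℕₚ.+-suc j M) sj+M≡q))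

    -- Now p - n is even and `Q-odd` leaves only B_{p-n}. The exponent p - n reflects to n - 1, and
    -- ½ turns n 6^{n-1} in the denominator into 2 n 6^{n-1}.
    odd-case : suc (suc j) % 2 ≡ 1 → LHS (suc (suc j)) (suc q) ≋ RHSodd (suc (suc j)) (suc q)
    odd-case n-odd = ≋-trans LHS≋ (reduce M refl 2≤M)
      where
      open SetoidReasoning ≋-setoid
      J = ℕ→ℚ (suc j !)
      e′ = suc j
      d = suc e′ ℕ.* 6 ℕ.^ e′
      -- This is n + 1 < p; it puts M in the range where `B⁺` and `B` agree.
      2≤M : 2 ℕ.≤ M
      2≤M = ℕₚ.m+n≤o⇒m≤o∸n 2 n<q
      pow-M : pow (- 1ℚ) M ≡ 1ℚ
      pow-M = trans (alg (pow (- 1ℚ) M)) (cong (- 1ℚ *_) (trans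
        (cong (_* pow (- 1ℚ) M) (sym (pow-minus1-odd (suc (suc j)) n-odd))) pow-p))
        where
        alg : ∀ x → x ≡ - 1ℚ * (- 1ℚ * x)
        alg = solve-∀ ℚ-ring
      p∤d : ¬ (suc q ∣ d)
      p∤d = p∤m*n (0<k<p⇒p∤k (ℕₚ.<-trans n<q (ℕₚ.n<1+n q)) z<s) (p∤6^ e′)
      p∤2d : ¬ (suc q ∣ 2 ℕ.* suc e′ ℕ.* 6 ℕ.^ e′)
      p∤2d = subst (λ k → ¬ (suc q ∣ k)) (sym (ℕₚ.*-assoc 2 (suc e′) (6 ℕ.^ e′))) (p∤m*n p∤2 p∤d)
      ½inv : ½ * inv d ≡ inv (2 ℕ.* suc e′ ℕ.* 6 ℕ.^ e′)
      ½inv = trans (sym (ℚₚ.*-identityˡ (½ * inv d))) (trans (cong (_* (½ * inv d)) (sym (inv-inverse k p∤2d)))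
        (trans (cong (λ x → I * x * (½ * inv d)) (trans (cong ℕ→ℚ (ℕₚ.*-assoc 2 (suc e′) (6 ℕ.^ e′))) (ℕ→ℚ-* 2 d)))
          (trans (alg I (ℕ→ℚ d) (inv d)) (trans (cong (I *_) (inv-inverse d p∤d)) (ℚₚ.*-identityʳ I)))))
        where
        k = 2 ℕ.* suc e′ ℕ.* 6 ℕ.^ e′
        I = inv k
        alg : ∀ i d v → i * (ℕ→ℚ 2 * d) * (½ * v) ≡ i * (v * d)
        alg = solve-∀ ℚ-ring
      g = ℕ→ℚ (3 ℕ.^ e′ ∸ 1) * ℕ→ℚ (2 ℕ.^ e′ ∸ 1)
      alg₁ : ∀ h g b i → h * - (g * b * i) - b ≡ - ((1ℚ - h * - (g * i)) * b)
      alg₁ = solve-∀ ℚ-ring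
      alg₂ : ∀ h g i → h * (g * i) ≡ g * (h * i)
      alg₂ = solve-∀ ℚ-ring
      alg₃ : ∀ c x b → c * - (x * b) ≡ - (c * x * b)
      alg₃ = solve-∀ ℚ-ring
      Q-value : ∀ m → suc (suc m) ≡ M → Q (suc M) ≋ - ((1ℚ - g * inv (2 ℕ.* suc e′ ℕ.* 6 ℕ.^ e′)) * B M)
      Q-value m ssm≡M = begin
        Q (suc M)
          ≡⟨ cong (Q ∘ suc) ssm≡M ⟨
        Q (suc K)
          ≡⟨ Q-odd m (trans (cong (pow (- 1ℚ)) ssm≡M) pow-M) ⟩
        ½ * F K - B K
          ≡⟨ cong (λ x → ½ * x - B K) (trans (F-closed (suc m)) (cong (λ x → - (γ K * x * inv K)) (B⁺≡B m))) ⟩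
        ½ * - (γ K * B K * inv K) - B K
          ≡⟨ alg₁ ½ (γ K) (B K) (inv K) ⟩
        - ((1ℚ - ½ * - (γ K * inv K)) * B K)
          ≈⟨ neg-cong-≋ (*-congʳ-≋ (B-integral K (subst (ℕ._< q) (sym ssm≡M) M<q)) (minus-cong-≋ (≋-refl {1ℚ})
               (*-congˡ-≋ (inv-integral 2 p∤2) (γ/n-reflect e′ (suc m) (trans (cong (e′ ℕ.+_) ssm≡M) sj+M≡q))))) ⟩
        - ((1ℚ - ½ * (γ e′ * inv d)) * B K)
          ≡⟨ cong₂ (λ x k → - ((1ℚ - x) * B k)) (trans (alg₂ ½ (γ e′) (inv d)) (cong₂ _*_
               (sym (cong₂ _*_ (ℕ→ℚ-power∸1 2 e′) (ℕ→ℚ-power∸1 1 e′))) ½inv)) ssm≡M ⟩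
        - ((1ℚ - g * inv (2 ℕ.* suc e′ ℕ.* 6 ℕ.^ e′)) * B M) ∎
        where K = suc (suc m)
      reduce : ∀ m → m ≡ M → 2 ℕ.≤ m → J * Q (suc M) ≋ RHSodd (suc (suc j)) (suc q)
      reduce 1             _     (s≤s ())
      reduce (suc (suc m)) ssm≡M _ = ≋-trans (*-congˡ-≋ (ℕ-integral (suc j !)) (Q-value m ssm≡M))
        (≋-reflexive (alg₃ J (1ℚ - g * inv (2 ℕ.* suc e′ ℕ.* 6 ℕ.^ e′)) (B M)))

theorem1p3 : (n p : ℕ) → 2 ℕ.≤ n → Prime p → n ℕ.+ 1 ℕ.< p →
    ((n % 2 ≡ 0 → LHS n p ≡ RHSeven n p [modℚ p ])
    × (n % 2 ≡ 1 → LHS n p ≡ RHSodd n p [modℚ p ]))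
theorem1p3 1             p       (s≤s ()) _ _
theorem1p3 (suc (suc j)) (suc q) _ p-prime (s≤s n+1≤q) =
  (λ h → ≋⇒≡[mod] (even-case h)) , (λ h → ≋⇒≡[mod] (odd-case h))
  where
  n<q : suc (suc j) ℕ.< q
  n<q = subst (ℕ._≤ q) (ℕₚ.+-comm (suc (suc j)) 1) n+1≤q
  open ModPrime (suc q) p-prime using (≋⇒≡[mod])
  open Reduction q p-prime (s≤s (ℕₚ.≤-trans (s≤s (s≤s (s≤s z≤n))) n<q))
  open Cases j n<q
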